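{- Let $G$ be a $5$-regular graph that has no $\{4,1\}$-factor, and which is vertex-minimal with this property (every $5$-regular graph with fewer vertices than $G$ has a $\{4,1\}$-factor). Then: (a) $G$ is connected. (b) $G$ is not $4$-edge-connected, i.e., $G$ contains an edge cut on $3$ edges. (c) $G$ has no minimal edge cut of size $2$. (d) $G$ does not have two bridges. (e) Each bridge in $G$ has precisely one endpoint incident to two loops. (f) The edges of any minimal edge cut of size $3$ in $G$ have a vertex in common, and this vertex is incident to a loop.
   Context: All graphs are finite, undirected pseudographs (multiple edges and loops allowed; a loop contributes $2$ to the degree). For a set $S$ of integers, an $S$-factor of a graph is a spanning subgraph in which the degree of every vertex lies in $S$; thus a $\{4,1\}$-factor is a spanning subgraph in which every vertex has degree $4$ or $1$. A set $S$ of edges of a connected graph $G$ is an edge cut if $G-S$ is disconnected; it is minimal if $G-(S\setminus\{e\})$ is connected for every $e\in S$. A bridge is an edge cut of size $1$. -}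

module Defs where

open import Data.Nat using (ℕ; _+_; _<_)
open import Data.Bool using (Bool; true; false; if_then_else_; _∧_)
open import Data.Fin using (Fin; _≟_)
open import Data.Fin.Subset using (Subset; _∈_; _∉_; ∁; _-_; ⁅_⁆; ⊤; ∣_∣)
open import Data.Vec using (lookup)
open import Data.List using (map; allFin)
open import Data.Nat.ListAction using (sum)
open import Data.Product using (_×_; _,_; Σ; ∃; ∃-syntax; proj₁; proj₂)
open import Data.Sum using (_⊎_)
open import Relation.Nullary using (¬_)
open import Relation.Nullary.Decidable using (⌊_⌋)
open import Relation.Binary.PropositionalEquality using (_≡_; _≢_)
open import Relation.Binary.Construct.Closure.ReflexiveTransitive using (Star)

-- A finite pseudograph: vertices Fin n, edges Fin m, each edge has an
-- (unordered) pair of endpoints.  Loops: both ends equal.  Parallel edges allowed.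
record Graph : Set where
  field
    n    : ℕ
    m    : ℕ
    ends : Fin m → Fin n × Fin n
open Graph public

Vertex : Graph → Set
Vertex G = Fin (n G)

Edge : Graph → Set
Edge G = Fin (m G)

-- number of ends of an edge at vertex v (a loop at v counts 2)
incidence : ∀ {k} → Fin k → Fin k × Fin k → ℕ
incidence v (a , b) = (if ⌊ a ≟ v ⌋ then 1 else 0) + (if ⌊ b ≟ v ⌋ then 1 else 0)

degreeIn : (G : Graph) → Subset (m G) → Vertex G → ℕ
degreeIn G F v =
  sum (map (λ e → if lookup F e then incidence v (ends G e) else 0) (allFin (m G)))

degree : (G : Graph) → Vertex G → ℕ
degree G v = degreeIn G ⊤ v

Regular : ℕ → Graph → Set
Regular r G = ∀ v → degree G v ≡ r

Is41Factor : (G : Graph) → Subset (m G) → Set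
Is41Factor G F = ∀ v → (degreeIn G F v ≡ 4) ⊎ (degreeIn G F v ≡ 1)

Has41Factor : Graph → Set
Has41Factor G = ∃[ F ] Is41Factor G F

AdjIn : (G : Graph) → Subset (m G) → Vertex G → Vertex G → Set
AdjIn G F u w = ∃[ e ] (e ∈ F × (ends G e ≡ (u , w) ⊎ ends G e ≡ (w , u)))

ConnectedIn : (G : Graph) → Subset (m G) → Set
ConnectedIn G F = ∀ u v → Star (AdjIn G F) u v

Connected : Graph → Set
Connected G = ConnectedIn G ⊤

EdgeCut : (G : Graph) → Subset (m G) → Set
EdgeCut G S = Connected G × ¬ ConnectedIn G (∁ S)

MinimalEdgeCut : (G : Graph) → Subset (m G) → Set
MinimalEdgeCut G S = EdgeCut G S × (∀ e → e ∈ S → ConnectedIn G (∁ (S - e)))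

IsBridge : (G : Graph) → Edge G → Set
IsBridge G e = EdgeCut G ⁅ e ⁆

loopCount : (G : Graph) → Vertex G → ℕ
loopCount G v =
  sum (map (λ e → if ⌊ proj₁ (ends G e) ≟ v ⌋ ∧ ⌊ proj₂ (ends G e) ≟ v ⌋ then 1 else 0)
           (allFin (m G)))

IncidentToLoop : (G : Graph) → Vertex G → Set
IncidentToLoop G v = ∃[ e ] (ends G e ≡ (v , v))

IncidentTo : (G : Graph) → Edge G → Vertex G → Set
IncidentTo G e v = proj₁ (ends G e) ≡ v ⊎ proj₂ (ends G e) ≡ v

{-# OPTIONS --safe #-}

-- For a vertex set X, let a pattern be the trace of a spanning subgraph on the edges leaving X. The complement of
-- a {4,1}-factor is a {4,1}-factor, so patterns matter only up to complement, and factors of the two sides with a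
-- common pattern glue to a factor of G. Replacing one side of a small cut by a gadget with at most one vertex
-- gives a smaller 5-regular graph, whose factor provides a pattern of the other side: nothing for 0 edges, a
-- vertex with two loops for 1 edge, a single edge for 2 edges. For 3 edges there are four patterns up to complement.
-- A vertex with one loop provides a nonconstant pattern, and joining two of the edges while ending the third in a
-- vertex with two loops provides a pattern that is constant on these two; hence each side has the constant pattern
-- or all the others, and has some nonconstant one, so the two sides share a pattern.
--
-- Cuts given by X and Y have symmetric difference the cut given by X △ Y, so two bridges yield a 2-edge cut.
--
-- If all cuts had at least 4 edges, odd sets would be left by at least 5 edges by parity, which is Tutte's condition
-- by double counting, and a perfect matching is a {4,1}-factor. Tutte's theorem is proved by Anderson's argument:
-- in a maximal tight barrier nothing but the odd classes remains, Hall's theorem matches the classes into S, and a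
-- class minus its matched vertex satisfies Tutte's condition again by maximality. It is used to refute, so it is
-- enough to have it up to double negation, where excluded middle is available.

module Submission where

open import Defs
open import Algebra.Bundles using (CommutativeRing)
open import Algebra.Properties.CommutativeMonoid.Sum using (sum-remove; sum-permute; ∑-comm; ∑-distrib-+)
open import Algebra.Properties.CommutativeSemigroup using (interchange)
open import Data.Bool as Bool using (Bool; true; false; if_then_else_; _∧_; _∨_; not; _xor_)
open import Data.Bool.Properties using (∧-identityʳ; not-injective; xor-same; xor-identityʳ; xor-∧-commutativeRing)
open import Data.Empty using (⊥; ⊥-elim)
open import Data.Fin using (Fin; zero; suc; _≟_; punchIn; _↑ˡ_; _↑ʳ_; splitAt)
open import Data.Fin.Patterns
open import Data.Fin.Permutation using (Permutation′; transpose; _⟨$⟩ʳ_; _⟨$⟩ˡ_; inverseʳ; inverseˡ)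
open import Data.Fin.Properties using (all?; any?; suc-injective)
open import Data.Fin.Subset as Subset using (Subset; ∣_∣; _∈_; ∁)
open import Data.Fin.Subset.Properties using (anySubset?; x∈⁅y⁆⇒x≡y; x∈p∧x≢y⇒x∈p-y)
import Data.List as List
open import Data.List.Properties using (map-tabulate)
open import Data.Nat using (ℕ; zero; suc; _+_; _*_; _≤_; _<_; z≤n; s≤s; _≡ᵇ_)
import Data.Nat.ListAction as ListAction
open import Data.Nat.Properties hiding (_≟_; suc-injective)
open import Data.Nat.Tactic.RingSolver using (solve-∀)
open import Data.Product using (_×_; _,_; ∃-syntax; Σ-syntax; proj₁; proj₂)
open import Data.Sum using (_⊎_; inj₁; inj₂; map₂)
open import Data.Vec using (lookup; tabulate; []; _∷_)
open import Data.Vec.Functional using (_++_) renaming ([] to ⟨⟩; _∷_ to infixr 5 _▹_)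
open import Data.Vec.Functional.Properties using (lookup-++ˡ; lookup-++ʳ)
open import Data.Vec.Properties using (lookup∘tabulate; lookup-replicate; lookup-map; []=⇒lookup; lookup⇒[]=)
open import Function using (_∘_)
open import Relation.Binary.Construct.Closure.ReflexiveTransitive using (Star; ε; _◅_; _◅◅_)
open import Relation.Binary.PropositionalEquality hiding ([_])
open import Relation.Nullary using (¬_; Dec; yes; no; contradiction)
open import Relation.Nullary.Decidable using (⌊_⌋; _×-dec_; _→-dec_; ¬¬-excluded-middle)
open import Algebra.Properties.Monoid.Sum +-0-monoid using (sum; sum-cong-≗)

private
  variable
    c j k l q r : ℕ

-- Indicators, finite sums and cardinalities.

⟦_⟧ : Bool → ℕ
⟦ b ⟧ = if b then 1 else 0

infixl 7 _·_
_·_ : Bool → ℕ → ℕ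
b · x = if b then x else 0

infix 5 _==_
_==_ : Fin k → Fin k → Bool
a == b = ⌊ a ≟ b ⌋

VSet : ℕ → Set
VSet k = Fin k → Bool

-- Opaque, so that unification can recover a summand from its sum.
opaque
  ∑ : (Fin k → ℕ) → ℕ
  ∑ = sum

count : VSet k → ℕ
count p = ∑ (λ i → ⟦ p i ⟧)

true≢false : ∀ {b} → b ≡ true → b ≡ false → ⊥
true≢false refl ()

==-refl : (a : Fin k) → (a == a) ≡ true
==-refl a with a ≟ a
... | yes _ = refl
... | no a≢a = contradiction refl a≢a

==⇒≡ : {a b : Fin k} → (a == b) ≡ true → a ≡ b
==⇒≡ {a = a} {b} p with a ≟ b
... | yes q = q
==⇒≡ () | no _

≢⇒==false : {a b : Fin k} → a ≢ b → (a == b) ≡ false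
≢⇒==false {a = a} {b} a≢b with a ≟ b
... | yes q = contradiction q a≢b
... | no _ = refl

==-separates : (X : VSet k) {a b : Fin k} → X a ≡ true → X b ≡ false → (a == b) ≡ false
==-separates X p q = ≢⇒==false λ { refl → true≢false p q }

==-sym : (a b : Fin k) → (a == b) ≡ (b == a)
==-sym a b with a ≟ b
... | yes refl = sym (==-refl a)
... | no a≢b = sym (≢⇒==false (a≢b ∘ sym))

==-suc : (a b : Fin k) → (suc a == suc b) ≡ (a == b)
==-suc a b with a ≟ b
... | yes refl = refl
... | no _ = refl

⟦⟧-pos : ∀ {b} → 1 ≤ ⟦ b ⟧ → b ≡ true
⟦⟧-pos {true} _ = refl

⟦⟧-injective : ∀ {b c} → ⟦ b ⟧ ≡ ⟦ c ⟧ → b ≡ c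
⟦⟧-injective {true} {true} _ = refl
⟦⟧-injective {false} {false} _ = refl

⟦⟧≤1 : ∀ b → ⟦ b ⟧ ≤ 1
⟦⟧≤1 true = ≤-refl
⟦⟧≤1 false = z≤n

⟦⟧-∨ : ∀ b c → ⟦ b ∨ c ⟧ ≤ ⟦ b ⟧ + ⟦ c ⟧
⟦⟧-∨ true c = s≤s z≤n
⟦⟧-∨ false c = ≤-refl

·-⟦⟧ : ∀ b c → b · ⟦ c ⟧ ≡ c · ⟦ b ⟧
·-⟦⟧ true true = refl
·-⟦⟧ true false = refl
·-⟦⟧ false true = refl
·-⟦⟧ false false = refl

opaque
  unfolding ∑

  ∑-cong : {f g : Fin k → ℕ} → (∀ i → f i ≡ g i) → ∑ f ≡ ∑ g
  ∑-cong = sum-cong-≗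

  ∑-+ : (f g : Fin k → ℕ) → ∑ (λ i → f i + g i) ≡ ∑ f + ∑ g
  ∑-+ = ∑-distrib-+ +-0-commutativeMonoid

  ∑-swap : (f : Fin j → Fin k → ℕ) → ∑ (λ x → ∑ (λ y → f x y)) ≡ ∑ (λ y → ∑ (λ x → f x y))
  ∑-swap = ∑-comm +-0-commutativeMonoid

  ∑-removeAt : (f : Fin (suc k) → ℕ) (i : Fin (suc k)) → ∑ f ≡ f i + ∑ (f ∘ punchIn i)
  ∑-removeAt f i = sum-remove +-0-commutativeMonoid {i = i} f

  ∑-permute : (f : Fin k → ℕ) (π : Permutation′ k) → ∑ f ≡ ∑ (λ i → f (π ⟨$⟩ʳ i))
  ∑-permute = sum-permute +-0-commutativeMonoid

  ∑-mono : {f g : Fin k → ℕ} → (∀ i → f i ≤ g i) → ∑ f ≤ ∑ g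
  ∑-mono {zero} _ = z≤n
  ∑-mono {suc k} p = +-mono-≤ (p zero) (∑-mono (p ∘ suc))

  ∑-const : ∀ c → ∑ {k} (λ _ → c) ≡ k * c
  ∑-const {zero} c = refl
  ∑-const {suc k} c = cong (c +_) (∑-const {k} c)

  ∑-* : ∀ c (f : Fin k → ℕ) → ∑ (λ i → c * f i) ≡ c * ∑ f
  ∑-* {zero} c f = sym (*-zeroʳ c)
  ∑-* {suc k} c f = trans (cong (c * f zero +_) (∑-* c (f ∘ suc))) (sym (*-distribˡ-+ c (f zero) _))

opaque
  unfolding ∑

  ∑-suc : (f : Fin (suc k) → ℕ) → ∑ f ≡ f zero + ∑ (f ∘ suc)
  ∑-suc f = refl

  ∑₀ : (f : Fin 0 → ℕ) → ∑ f ≡ 0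
  ∑₀ f = refl

  ∑₁ : (f : Fin 1 → ℕ) → ∑ f ≡ f 0F
  ∑₁ f = +-identityʳ _

  ∑₂ : (f : Fin 2 → ℕ) → ∑ f ≡ f 0F + f 1F
  ∑₂ f = cong (f 0F +_) (+-identityʳ _)

  ∑₃ : (f : Fin 3 → ℕ) → ∑ f ≡ f 0F + (f 1F + f 2F)
  ∑₃ f = cong (λ x → f 0F + (f 1F + x)) (+-identityʳ _)

  ∑₄ : (f : Fin 4 → ℕ) → ∑ f ≡ f 0F + (f 1F + (f 2F + f 3F))
  ∑₄ f = cong (λ x → f 0F + (f 1F + (f 2F + x))) (+-identityʳ _)

∑-zero : {f : Fin k → ℕ} → (∀ i → f i ≡ 0) → ∑ f ≡ 0
∑-zero {k} p = trans (∑-cong p) (trans (∑-const {k} 0) (*-zeroʳ k))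

opaque
  unfolding ∑

  term≤∑ : (f : Fin k → ℕ) (i : Fin k) → f i ≤ ∑ f
  term≤∑ f zero = m≤m+n _ _
  term≤∑ f (suc i) = ≤-trans (term≤∑ (f ∘ suc) i) (m≤n+m _ _)

∑≡0⇒≡0 : (f : Fin k → ℕ) → ∑ f ≡ 0 → ∀ i → f i ≡ 0
∑≡0⇒≡0 f p i = n≤0⇒n≡0 (subst (f i ≤_) p (term≤∑ f i))

opaque
  unfolding ∑

  -- Slack in one term would survive in the total, since no other term can make up for it. It serves
  -- to show that an injection from the classes of a tight packing into `S` is onto.
  ∑-tight : {f g : Fin k → ℕ} → (∀ i → f i ≤ g i) → ∑ g ≤ ∑ f → ∀ i → f i ≡ g i
  ∑-tight {suc k} {f} {g} p q zero = ≤-antisym (p zero)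
    (+-cancelʳ-≤ (∑ (f ∘ suc)) _ _ (≤-trans (+-monoʳ-≤ (g zero) (∑-mono (p ∘ suc))) q))
  ∑-tight {suc k} {f} {g} p q (suc i) = ∑-tight (p ∘ suc)
    (+-cancelˡ-≤ (f zero) _ _ (≤-trans (+-monoˡ-≤ _ (p zero)) q)) i

  ∑-point : (g : Fin k → ℕ) (a : Fin k) → ∑ (λ v → (a == v) · g v) ≡ g a
  ∑-point {suc k} g zero = trans (cong (g zero +_) (∑-zero {f = λ v → (zero == suc v) · g (suc v)} λ _ → refl)) (+-identityʳ _)
  ∑-point {suc k} g (suc a) =
    trans (∑-cong (λ v → cong (_· g (suc v)) (==-suc a v))) (∑-point (g ∘ suc) a)

∑-indicator : (X : VSet k) (a : Fin k) → ∑ (λ v → X v · ⟦ a == v ⟧) ≡ ⟦ X a ⟧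
∑-indicator X a = trans (∑-cong (λ v → ·-⟦⟧ (X v) (a == v))) (∑-point (λ v → ⟦ X v ⟧) a)

count-singleton : (a : Fin k) → count (a ==_) ≡ 1
count-singleton a = ∑-point (λ _ → 1) a

count-full : count {k} (λ _ → true) ≡ k
count-full {k} = trans (∑-const {k} 1) (*-identityʳ k)

count≤size : (p : VSet k) → count p ≤ k
count≤size p = subst (count p ≤_) count-full (∑-mono (⟦⟧≤1 ∘ p))

member⇒count>0 : (p : VSet k) (i : Fin k) → p i ≡ true → 1 ≤ count p
member⇒count>0 p i q = subst (_≤ count p) (cong ⟦_⟧ q) (term≤∑ (λ i → ⟦ p i ⟧) i)

opaque
  unfolding ∑

  count>0⇒member : (p : VSet k) → 1 ≤ count p → ∃[ i ] p i ≡ true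
  count>0⇒member {suc k} p q with p zero in eq
  ... | true = zero , eq
  ... | false with count>0⇒member (p ∘ suc) q
  ... | i , r = suc i , r

count≡0⇒empty : (p : VSet k) → count p ≡ 0 → ∀ i → p i ≡ false
count≡0⇒empty p q i with p i in eq
... | false = refl
... | true = contradiction (member⇒count>0 p i eq) (<⇒≱ (s≤s (≤-reflexive q)))

count-not : (p : VSet k) → count p + count (not ∘ p) ≡ k
count-not p = trans (sym (∑-+ (λ i → ⟦ p i ⟧) (λ i → ⟦ not (p i) ⟧)))
  (trans (∑-cong λ i → complementary (p i)) count-full)
  where
  complementary : ∀ b → ⟦ b ⟧ + ⟦ not b ⟧ ≡ 1
  complementary true = refl
  complementary false = refl

count-∨ : (p q : VSet k) → count (λ i → p i ∨ q i) ≤ count p + count q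
count-∨ p q = ≤-trans (∑-mono λ i → ⟦⟧-∨ (p i) (q i)) (≤-reflexive (∑-+ _ _))

opaque
  unfolding ∑

  ∣tabulate∣ : (p : VSet k) → ∣ tabulate p ∣ ≡ count p
  ∣tabulate∣ {zero} p = refl
  ∣tabulate∣ {suc k} p with p zero
  ... | true = cong suc (∣tabulate∣ (p ∘ suc))
  ... | false = ∣tabulate∣ (p ∘ suc)

  ∣∣≡count : (S : Subset k) → ∣ S ∣ ≡ count (lookup S)
  ∣∣≡count [] = refl
  ∣∣≡count (true ∷ S) = cong suc (∣∣≡count S)
  ∣∣≡count (false ∷ S) = ∣∣≡count S

  listSum≡∑ : (f : Fin k → ℕ) → ListAction.sum (List.map f (List.allFin k)) ≡ ∑ f
  listSum≡∑ f = trans (cong ListAction.sum (map-tabulate (λ i → i) f)) (go f)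
    where
    go : (f : Fin k → ℕ) → ListAction.sum (List.tabulate f) ≡ ∑ f
    go {zero} f = refl
    go {suc k} f = cong (f zero +_) (go (f ∘ suc))

opaque
  unfolding ∑

  -- Pads an edge cut of fewer than three edges to exactly three, the size that part (b) asks for.
  count-extend : (p : VSet k) (c : ℕ) → count p ≤ c → c ≤ k →
                 ∃[ q ] (count q ≡ c × (∀ i → p i ≡ true → q i ≡ true))
  count-extend {zero} p zero _ _ = p , refl , λ _ r → r
  count-extend {suc k} p c pc ck with p zero in eq
  count-extend {suc k} p (suc c) (s≤s pc) (s≤s ck) | true with count-extend (p ∘ suc) c pc ck
  ... | q , cq , sub = (λ { zero → true ; (suc i) → q i }) , cong suc cq , λ { zero _ → refl ; (suc i) r → sub i r }
  count-extend {suc k} p c pc ck | false with c ≤? k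
  ... | yes c≤k with count-extend (p ∘ suc) c pc c≤k
  ... | q , cq , sub = (λ { zero → false ; (suc i) → q i }) , cq ,
        λ { zero r → ⊥-elim (true≢false r eq) ; (suc i) r → sub i r }
  -- Here `c` is the size of the whole set, so every element has to be taken.
  count-extend {suc k} p c pc ck | false | no c≰k =
    (λ _ → true) , trans (count-full {suc k}) (≤-antisym (≰⇒> c≰k) ck) , λ _ _ → refl

-- Enumerations of finite sets.

record Enum {k} (p : VSet k) (c : ℕ) : Set where
  field
    emb       : Fin c → Fin k
    emb-inj   : ∀ {i i′} → emb i ≡ emb i′ → i ≡ i′
    emb-mem   : ∀ i → p (emb i) ≡ true
    idx       : ∀ x → p x ≡ true → Fin c
    emb-idx   : ∀ x px → emb (idx x px) ≡ x
    -- Reindexing of sums, by which degrees are compared between a graph and its renumbered parts.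
    ∑-emb     : ∀ (g : Fin k → ℕ) → ∑ (g ∘ emb) ≡ ∑ (λ x → p x · g x)

  idx-emb : ∀ i q → idx (emb i) q ≡ i
  idx-emb i q = emb-inj (emb-idx (emb i) q)

open Enum public

opaque
  unfolding ∑

  enum : (p : VSet k) → Enum p (count p)
  enum {zero} p = record
    { emb = λ () ; emb-inj = λ { {()} } ; emb-mem = λ () ; idx = λ () ; emb-idx = λ () ; ∑-emb = λ _ → refl }
  enum {suc k} p with p zero in eq | enum (p ∘ suc)
  ... | true | E = record
    { emb = λ { zero → zero ; (suc i) → suc (emb E i) }
    ; emb-inj = λ { {zero} {zero} _ → refl
                  ; {zero} {suc _} ()
                  ; {suc _} {zero} ()
                  ; {suc i} {suc i′} q → cong suc (emb-inj E (suc-injective q)) }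
    ; emb-mem = λ { zero → eq ; (suc i) → emb-mem E i }
    ; idx = λ { zero _ → zero ; (suc x) q → suc (idx E x q) }
    ; emb-idx = λ { zero _ → refl ; (suc x) q → cong suc (emb-idx E x q) }
    ; ∑-emb = λ g → cong₂ _+_ (cong (_· g zero) (sym eq)) (∑-emb E (g ∘ suc)) }
  ... | false | E = record
    { emb = λ i → suc (emb E i)
    ; emb-inj = λ q → emb-inj E (suc-injective q)
    ; emb-mem = emb-mem E
    ; idx = λ { zero q → ⊥-elim (true≢false q eq) ; (suc x) q → idx E x q }
    ; emb-idx = λ { zero q → ⊥-elim (true≢false q eq) ; (suc x) q → cong suc (emb-idx E x q) }
    ; ∑-emb = λ g → cong₂ _+_ (cong (_· g zero) (sym eq)) (∑-emb E (g ∘ suc)) }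

enumOf : (p : VSet k) {c : ℕ} → count p ≡ c → Enum p c
enumOf p refl = enum p

extendLabel : {p : VSet k} {c : ℕ} (E : Enum p c) (f : Fin c → Bool) →
              ∃[ F ] (∀ i → F (emb E i) ≡ f i)
extendLabel {p = p} E f = (λ x → pick x (p x) refl) , λ i → pick-emb i _ refl
  where
  pick : ∀ x b → p x ≡ b → Bool
  pick x true q = f (idx E x q)
  pick x false _ = false
  pick-emb : ∀ i b (q : p (emb E i) ≡ b) → pick (emb E i) b q ≡ f i
  pick-emb i true q = cong f (idx-emb E i q)
  pick-emb i false q = ⊥-elim (true≢false (emb-mem E i) q)

opaque
  unfolding ∑

  ∑-split : ∀ j (h : Fin (j + k) → ℕ) → ∑ h ≡ ∑ (λ i → h (i ↑ˡ k)) + ∑ (λ i → h (j ↑ʳ i))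
  ∑-split zero h = refl
  ∑-split (suc j) h = trans (cong (h zero +_) (∑-split j (h ∘ suc))) (sym (+-assoc (h zero) _ _))

∧-· : ∀ b c x → b · (c · x) ≡ (b ∧ c) · x
∧-· true c x = refl
∧-· false c x = refl

-- Degrees, factors, and graphs on fewer vertices.

Is41 : ℕ → Set
Is41 d = d ≡ 4 ⊎ d ≡ 1

degF : (Fin l → Fin k × Fin k) → VSet l → Fin k → ℕ
degF en F v = ∑ (λ e → F e · incidence v (en e))

degreeIn≡degF : (G : Graph) (F : Subset (m G)) (v : Vertex G) → degreeIn G F v ≡ degF (ends G) (lookup F) v
degreeIn≡degF G F v = listSum≡∑ _

degree≡degF : (G : Graph) (v : Vertex G) → degree G v ≡ degF (ends G) (λ _ → true) v
degree≡degF G v = trans (degreeIn≡degF G Subset.⊤ v)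
  (∑-cong λ e → cong (_· incidence v (ends G e)) (lookup-replicate e true))

idx-== : {p : VSet k} {c : ℕ} (E : Enum p c) (u : Fin k) (pu : p u ≡ true) (i : Fin c) →
         (idx E u pu == i) ≡ (u == emb E i)
idx-== E u pu i with idx E u pu ≟ i
... | yes refl = sym (trans (cong (u ==_) (emb-idx E u pu)) (==-refl u))
... | no i≢ = sym (≢⇒==false λ { refl → i≢ (idx-emb E i pu) })

module _ (N : ℕ) (smaller : ∀ H → n H < N → Regular 5 H → Has41Factor H) where

  opaque

    -- The subgraph with vertices `Z` and edges `A` is renumbered to a `Graph`, to which minimality
    -- applies; its factor is pulled back to a labelling of all of `Fin l`.
    factor-on : (en : Fin l → Fin k × Fin k) (A : VSet l) (Z : VSet k) → count Z < N →
                (∀ e → A e ≡ true → Z (proj₁ (en e)) ≡ true × Z (proj₂ (en e)) ≡ true) →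
                (∀ v → Z v ≡ true → degF en A v ≡ 5) →
                Σ[ F ∈ VSet l ] (∀ v → Z v ≡ true → Is41 (degF en (λ e → A e ∧ F e) v))
    factor-on {l = l} en A Z Z<N closed deg5 = F , λ v Zv →
      subst Is41 (trans (degree-eq (idx EZ v Zv)) (cong (degF en (λ e → A e ∧ F e)) (emb-idx EZ v Zv)))
            (proj₂ factor (idx EZ v Zv))
      where
      open ≡-Reasoning
      EZ : Enum Z (count Z)
      EZ = enum Z
      EA : Enum A (count A)
      EA = enum A
      H : Graph
      H = record { n = count Z ; m = count A ; ends = λ i →
        idx EZ (proj₁ (en (emb EA i))) (proj₁ (closed _ (emb-mem EA i))) ,
        idx EZ (proj₂ (en (emb EA i))) (proj₂ (closed _ (emb-mem EA i))) }
      incidence-eq : ∀ v i → incidence v (ends H i) ≡ incidence (emb EZ v) (en (emb EA i))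
      incidence-eq v i = cong₂ (λ x y → ⟦ x ⟧ + ⟦ y ⟧) (idx-== EZ _ _ v) (idx-== EZ _ _ v)
      regular : Regular 5 H
      regular v = begin
        degree H v ≡⟨ degree≡degF H v ⟩
        ∑ (λ i → incidence v (ends H i)) ≡⟨ ∑-cong (incidence-eq v) ⟩
        ∑ (λ i → incidence (emb EZ v) (en (emb EA i))) ≡⟨ ∑-emb EA _ ⟩
        degF en A (emb EZ v) ≡⟨ deg5 (emb EZ v) (emb-mem EZ v) ⟩
        5 ∎
      factor : Has41Factor H
      factor = smaller H Z<N regular
      F : VSet l
      F = proj₁ (extendLabel EA (lookup (proj₁ factor)))
      F-emb : ∀ i → F (emb EA i) ≡ lookup (proj₁ factor) i
      F-emb = proj₂ (extendLabel EA (lookup (proj₁ factor)))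
      degree-eq : ∀ v → degreeIn H (proj₁ factor) v ≡ degF en (λ e → A e ∧ F e) (emb EZ v)
      degree-eq v = begin
        degreeIn H (proj₁ factor) v ≡⟨ degreeIn≡degF H (proj₁ factor) v ⟩
        _ ≡⟨ ∑-cong (λ i → cong₂ _·_ (sym (F-emb i)) (incidence-eq v i)) ⟩
        ∑ (λ i → F (emb EA i) · incidence (emb EZ v) (en (emb EA i)))
          ≡⟨ ∑-emb EA (λ e → F e · incidence (emb EZ v) (en e)) ⟩
        ∑ (λ e → A e · (F e · incidence (emb EZ v) (en e)))
          ≡⟨ ∑-cong (λ e → ∧-· (A e) (F e) _) ⟩
        degF en (λ e → A e ∧ F e) (emb EZ v) ∎

-- Edge cuts, their patterns, and gluing.

Enum-cong : {p q : VSet k} → (∀ x → p x ≡ q x) → Enum p c → Enum q c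
Enum-cong p≗q E = record
  { emb = emb E
  ; emb-inj = emb-inj E
  ; emb-mem = λ i → trans (sym (p≗q _)) (emb-mem E i)
  ; idx = λ x q → idx E x (trans (p≗q x) q)
  ; emb-idx = λ x q → emb-idx E x _
  ; ∑-emb = λ g → trans (∑-emb E g) (∑-cong λ x → cong (_· g x) (p≗q x)) }

-- A pattern is read in the order of the enumeration, so reordering lets one gadget serve every pair
-- among three cut edges.
Enum-permute : {p : VSet k} → Permutation′ c → Enum p c → Enum p c
Enum-permute π E = record
  { emb = λ i → emb E (π ⟨$⟩ʳ i)
  ; emb-inj = λ {i} {i′} q → trans (sym (inverseˡ π)) (trans (cong (π ⟨$⟩ˡ_) (emb-inj E q)) (inverseˡ π))
  ; emb-mem = λ i → emb-mem E _
  ; idx = λ x q → π ⟨$⟩ˡ idx E x q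
  ; emb-idx = λ x q → trans (cong (emb E) (inverseʳ π)) (emb-idx E x q)
  ; ∑-emb = λ g → trans (sym (∑-permute (g ∘ emb E) π)) (∑-emb E g) }

module Cuts (en : Fin l → Fin k × Fin k) where

  -- Exclusive or makes the cut of a symmetric difference the symmetric difference of the cuts.
  cut : VSet k → VSet l
  cut X e = X (proj₁ (en e)) xor X (proj₂ (en e))

  ins : VSet k → VSet l
  ins X e = X (proj₁ (en e)) ∧ X (proj₂ (en e))

  -- Meant for cut edges, where it is the end in `X`; `inner (not ∘ X)` is then the end outside.
  inner : VSet k → Fin l → Fin k
  inner X e = if X (proj₁ (en e)) then proj₁ (en e) else proj₂ (en e)

  cut-not : (X : VSet k) (e : Fin l) → cut X e ≡ cut (not ∘ X) e
  cut-not X e with X (proj₁ (en e)) | X (proj₂ (en e))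
  ... | true | true = refl
  ... | true | false = refl
  ... | false | true = refl
  ... | false | false = refl

  inner∈ : (X : VSet k) {e : Fin l} → cut X e ≡ true → X (inner X e) ≡ true
  inner∈ X {e} p with X (proj₁ (en e)) in eqa | X (proj₂ (en e)) in eqb
  ... | true | false = eqa
  ... | false | true = eqb

  outer∉ : (X : VSet k) {e : Fin l} → cut X e ≡ true → X (inner (not ∘ X) e) ≡ false
  outer∉ X {e} p with X (inner (not ∘ X) e) | inner∈ (not ∘ X) {e} (trans (sym (cut-not X e)) p)
  ... | false | _ = refl

  cut-incidence : (X : VSet k) {v : Fin k} {e : Fin l} → X v ≡ true → cut X e ≡ true →
                  incidence v (en e) ≡ ⟦ inner X e == v ⟧
  cut-incidence X {v} {e} Xv p with X (proj₁ (en e)) in eqa | X (proj₂ (en e)) in eqb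
  ... | true | false rewrite trans (==-sym _ v) (==-separates X Xv eqb) = +-identityʳ _
  ... | false | true rewrite trans (==-sym _ v) (==-separates X Xv eqa) = refl

  incidence-outside : (X : VSet k) {v : Fin k} {e : Fin l} → X v ≡ true →
                      X (proj₁ (en e)) ≡ false → X (proj₂ (en e)) ≡ false → incidence v (en e) ≡ 0
  incidence-outside X {v} Xv eqa eqb rewrite trans (==-sym _ v) (==-separates X Xv eqa)
                                   | trans (==-sym _ v) (==-separates X Xv eqb) = refl

  deg : VSet l → Fin k → ℕ
  deg = degF en

  ·0 : ∀ b → b · 0 ≡ 0
  ·0 true = refl
  ·0 false = refl

  -- An edge with no end in `X` misses `v`, so only inner edges and cut edges contribute.
  deg-split : (X : VSet k) (F : VSet l) {v : Fin k} → X v ≡ true →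
              deg F v ≡ ∑ (λ e → (ins X e ∧ F e) · incidence v (en e))
                        + ∑ (λ e → cut X e · (F e · incidence v (en e)))
  deg-split X F {v} Xv = trans (∑-cong pointwise) (∑-+ _ _)
    where
    pointwise : ∀ e → F e · incidence v (en e) ≡ (ins X e ∧ F e) · incidence v (en e)
                                                 + cut X e · (F e · incidence v (en e))
    pointwise e with X (proj₁ (en e)) in eqa | X (proj₂ (en e)) in eqb
    ... | true | true = sym (+-identityʳ _)
    ... | true | false = refl
    ... | false | true = refl
    ... | false | false = trans (cong (F e ·_) (incidence-outside X Xv eqa eqb)) (·0 (F e))

  -- Only the labels of edges that meet `X` have any effect; the others are arbitrary.
  Real : VSet k → VSet l → Set
  Real X F = ∀ v → X v ≡ true → Is41 (deg F v)

  -- Edges that meet `X` follow `F₁` and the rest follow `F₂`. A vertex outside `X` sees the former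
  -- only through cut edges, where both labellings agree.
  glue : {X : VSet k} {F₁ F₂ : VSet l} → Real X F₁ → Real (not ∘ X) F₂ →
         (∀ e → cut X e ≡ true → F₁ e ≡ F₂ e) → ∃[ F ] (∀ v → Is41 (deg F v))
  glue {X} {F₁} {F₂} real₁ real₂ agree = F , is41
    where
    F : VSet l
    F e = if X (proj₁ (en e)) ∨ X (proj₂ (en e)) then F₁ e else F₂ e
    inside : ∀ {v} → X v ≡ true → ∀ e → F₁ e · incidence v (en e) ≡ F e · incidence v (en e)
    inside Xv e with X (proj₁ (en e)) in eqa | X (proj₂ (en e)) in eqb
    ... | true | _ = refl
    ... | false | true = refl
    ... | false | false rewrite incidence-outside X Xv eqa eqb = trans (·0 (F₁ e)) (sym (·0 (F₂ e)))
    outside : ∀ {v} → not (X v) ≡ true → ∀ e → F₂ e · incidence v (en e) ≡ F e · incidence v (en e)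
    outside {v} Xv e with X (proj₁ (en e)) in eqa | X (proj₂ (en e)) in eqb | agree e
    ... | true | true | _ rewrite incidence-outside (not ∘ X) {e = e} Xv (cong not eqa) (cong not eqb) =
      trans (·0 (F₂ e)) (sym (·0 (F₁ e)))
    ... | true | false | q = cong (_· incidence v (en e)) (sym (q refl))
    ... | false | true | q = cong (_· incidence v (en e)) (sym (q refl))
    ... | false | false | _ = refl
    is41 : ∀ v → Is41 (deg F v)
    is41 v with X v in eq
    ... | true = subst Is41 (∑-cong (inside eq)) (real₁ v eq)
    ... | false = subst Is41 (∑-cong (outside (cong not eq))) (real₂ v (cong not eq))

  deg-not : (F : VSet l) (v : Fin k) → deg F v + deg (not ∘ F) v ≡ deg (λ _ → true) v
  deg-not F v = trans (sym (∑-+ _ _)) (∑-cong λ e → pointwise (F e) _)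
    where
    pointwise : ∀ b x → b · x + not b · x ≡ x
    pointwise true x = +-identityʳ x
    pointwise false x = refl

  Realizes : (X : VSet k) → Enum (cut X) c → (Fin c → Bool) → Set
  Realizes X E p = ∃[ F ] (Real X F × (∀ i → F (emb E i) ≡ p i))

  Realizes-cong : (X : VSet k) (E : Enum (cut X) c) {p q : Fin c → Bool} → (∀ i → p i ≡ q i) →
                  Realizes X E p → Realizes X E q
  Realizes-cong X E p≗q (F , real , F-emb) = F , real , λ i → trans (F-emb i) (p≗q i)

  realizes-glue : (X : VSet k) (E : Enum (cut X) c) {p : Fin c → Bool} → Realizes X E p →
                  Realizes (not ∘ X) (Enum-cong (cut-not X) E) p → ∃[ F ] (∀ v → Is41 (deg F v))
  realizes-glue X E (F₁ , real₁ , F₁-emb) (F₂ , real₂ , F₂-emb) = glue real₁ real₂ λ e q →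
    subst (λ e → F₁ e ≡ F₂ e) (emb-idx E e q) (trans (F₁-emb _) (sym (F₂-emb _)))

  module Regular5 (regular : ∀ v → deg (λ _ → true) v ≡ 5) where

    -- As 4 + 1 = 5, complementation exchanges the two admissible degrees.
    Real-not : {X : VSet k} {F : VSet l} → Real X F → Real X (not ∘ F)
    Real-not {F = F} real v Xv = swap (real v Xv)
      where
      complement : ∀ d → deg F v ≡ d → d + deg (not ∘ F) v ≡ 5
      complement _ refl = trans (deg-not F v) (regular v)
      swap : Is41 (deg F v) → Is41 (deg (not ∘ F) v)
      swap (inj₁ q) = inj₂ (+-cancelˡ-≡ 4 _ _ (complement 4 q))
      swap (inj₂ q) = inj₁ (+-cancelˡ-≡ 1 _ _ (complement 1 q))

    Realizes-not : (X : VSet k) (E : Enum (cut X) c) {p : Fin c → Bool} → Realizes X E p → Realizes X E (not ∘ p)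
    Realizes-not X E (F , real , F-emb) = not ∘ F , Real-not real , λ i → cong not (F-emb i)

    -- Replacing one side of a cut by a gadget.

    module Surgery (smaller : ∀ H → n H < k → Regular 5 H → Has41Factor H) where

      -- Keep the graph induced on X and put the edges extra in place of the cut edges. A gadget vertex is a
      -- vertex of Z outside X, so that the new graph still lives inside Fin k.
      opaque

        surgery : (X : VSet k) (E : Enum (cut X) c) (extra : Fin j → Fin k × Fin k) (Z : VSet k) → count Z < k →
                  (∀ {v} → X v ≡ true → Z v ≡ true) →
                  (∀ i → Z (proj₁ (extra i)) ≡ true × Z (proj₂ (extra i)) ≡ true) →
                  (∀ v → X v ≡ true → ∑ (λ i → incidence v (extra i)) ≡ ∑ (λ i → ⟦ inner X (emb E i) == v ⟧)) →
                  (∀ v → Z v ≡ true → X v ≡ false → ∑ (λ i → incidence v (extra i)) ≡ 5) →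
                  ∃[ Fx ] ((∀ v → Z v ≡ true → X v ≡ false → Is41 (degF extra Fx v)) ×
                    (∀ p → (∀ v → X v ≡ true → ∑ (λ i → p i · ⟦ inner X (emb E i) == v ⟧) ≡ degF extra Fx v) → Realizes X E p))
        surgery {c = c} {j = j} X E extra Z Z<k X⊆Z extra⊆Z degX degZ = Fx , new , old
          where
          open ≡-Reasoning
          en′ : Fin (j + l) → Fin k × Fin k
          en′ = extra ++ en
          A : VSet (j + l)
          A = (λ (_ : Fin j) → true) ++ ins X
          closed : ∀ e → A e ≡ true → Z (proj₁ (en′ e)) ≡ true × Z (proj₂ (en′ e)) ≡ true
          closed e q with splitAt j e
          ... | inj₁ i = extra⊆Z i
          ... | inj₂ e′ with X (proj₁ (en e′)) in eqa | X (proj₂ (en e′)) in eqb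
          ... | true | true = X⊆Z eqa , X⊆Z eqb
          deg-en′ : ∀ (F : VSet (j + l)) v → degF en′ (λ e → A e ∧ F e) v ≡
                    degF extra (λ i → F (i ↑ˡ l)) v + ∑ (λ e → (ins X e ∧ F (j ↑ʳ e)) · incidence v (en e))
          deg-en′ F v = trans (∑-split j _) (cong₂ _+_
            (∑-cong λ i → cong₂ (λ x y → (x ∧ F (i ↑ˡ l)) · incidence v y)
               (lookup-++ˡ (λ (_ : Fin j) → true) (ins X) i) (lookup-++ˡ extra en i))
            (∑-cong λ e → cong₂ (λ x y → (x ∧ F (j ↑ʳ e)) · incidence v y)
               (lookup-++ʳ (λ (_ : Fin j) → true) (ins X) e) (lookup-++ʳ extra en e)))
          ins-outside : ∀ (F : VSet l) {v} → X v ≡ false → ∑ (λ e → (ins X e ∧ F e) · incidence v (en e)) ≡ 0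
          ins-outside F {v} q = ∑-zero pointwise
            where
            pointwise : ∀ e → (ins X e ∧ F e) · incidence v (en e) ≡ 0
            pointwise e with X (proj₁ (en e)) in eqa | X (proj₂ (en e)) in eqb
            ... | true | true rewrite incidence-outside (not ∘ X) {e = e} (cong not q) (cong not eqa) (cong not eqb) = ·0 (F e)
            ... | true | false = refl
            ... | false | _ = refl
          cut-part : ∀ (F : VSet l) {v} → X v ≡ true →
                     ∑ (λ e → cut X e · (F e · incidence v (en e))) ≡ ∑ (λ i → F (emb E i) · ⟦ inner X (emb E i) == v ⟧)
          cut-part F Xv = trans (sym (∑-emb E _))
            (∑-cong λ i → cong (F (emb E i) ·_) (cut-incidence X Xv (emb-mem E i)))
          deg5 : ∀ v → Z v ≡ true → degF en′ A v ≡ 5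
          deg5 v Zv = trans (∑-cong λ e → cong (_· incidence v (en′ e)) (sym (∧-identityʳ (A e))))
                      (trans (deg-en′ (λ _ → true) v) (go (X v) refl))
            where
            go : ∀ b → X v ≡ b → ∑ (λ i → incidence v (extra i)) + ∑ (λ e → (ins X e ∧ true) · incidence v (en e)) ≡ 5
            go true Xv = trans (trans (+-comm _ (∑ _)) (cong (∑ (λ e → (ins X e ∧ true) · incidence v (en e)) +_)
                (trans (degX v Xv) (sym (cut-part (λ _ → true) Xv)))))
              (trans (sym (deg-split X (λ _ → true) Xv)) (regular v))
            go false ¬Xv = trans (cong₂ _+_ (degZ v Zv ¬Xv) (ins-outside (λ _ → true) ¬Xv)) refl
          result : Σ[ F ∈ VSet (j + l) ] (∀ v → Z v ≡ true → Is41 (degF en′ (λ e → A e ∧ F e) v))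
          result = factor-on k smaller en′ A Z Z<k closed deg5
          F′ : VSet (j + l)
          F′ = proj₁ result
          Fx : VSet j
          Fx i = F′ (i ↑ˡ l)
          new : ∀ v → Z v ≡ true → X v ≡ false → Is41 (degF extra Fx v)
          new v Zv ¬Xv = subst Is41 (trans (deg-en′ F′ v) (trans (cong (degF extra Fx v +_) (ins-outside _ ¬Xv)) (+-identityʳ _)))
            (proj₂ result v Zv)
          old : ∀ p → (∀ v → X v ≡ true → ∑ (λ i → p i · ⟦ inner X (emb E i) == v ⟧) ≡ degF extra Fx v) → Realizes X E p
          old p degp = F , real , F-emb
            where
            P : Σ[ F ∈ VSet l ] (∀ i → F (emb E i) ≡ p i)
            P = extendLabel E p
            F : VSet l
            -- Cut edges carry `p`, inner edges keep their labels from the new graph. By the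
            -- hypothesis on `p`, the cut edges then give each vertex of `X` the degree that the
            -- extra edges gave it.
            F e = if cut X e then proj₁ P e else F′ (j ↑ʳ e)
            F-emb : ∀ i → F (emb E i) ≡ p i
            F-emb i = trans (cong (λ b → if b then proj₁ P (emb E i) else F′ (j ↑ʳ emb E i)) (emb-mem E i)) (proj₂ P i)
            F-ins : ∀ x y b b′ → ((x ∧ y) ∧ b) ≡ ((x ∧ y) ∧ (if x xor y then b′ else b))
            F-ins true true b b′ = refl
            F-ins true false b b′ = refl
            F-ins false y b b′ = refl
            real : Real X F
            real v Xv = subst Is41 (begin
              degF en′ (λ e → A e ∧ F′ e) v ≡⟨ deg-en′ F′ v ⟩
              degF extra Fx v + ∑ (λ e → (ins X e ∧ F′ (j ↑ʳ e)) · incidence v (en e)) ≡⟨ +-comm _ (∑ _) ⟩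
              ∑ (λ e → (ins X e ∧ F′ (j ↑ʳ e)) · incidence v (en e)) + degF extra Fx v
                ≡⟨ cong₂ _+_ (∑-cong λ e → cong (_· incidence v (en e)) (F-ins (X (proj₁ (en e))) _ _ _)) (sym (degp v Xv)) ⟩
              ∑ (λ e → (ins X e ∧ F e) · incidence v (en e)) + ∑ (λ i → p i · ⟦ inner X (emb E i) == v ⟧)
                ≡⟨ cong (∑ (λ e → (ins X e ∧ F e) · incidence v (en e)) +_) (∑-cong λ i → cong (_· ⟦ inner X (emb E i) == v ⟧) (sym (F-emb i))) ⟩
              ∑ (λ e → (ins X e ∧ F e) · incidence v (en e)) + ∑ (λ i → F (emb E i) · ⟦ inner X (emb E i) == v ⟧)
                ≡⟨ cong (∑ (λ e → (ins X e ∧ F e) · incidence v (en e)) +_) (sym (cut-part F Xv)) ⟩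
              ∑ (λ e → (ins X e ∧ F e) · incidence v (en e)) + ∑ (λ e → cut X e · (F e · incidence v (en e)))
                ≡⟨ deg-split X F Xv ⟨
              deg F v ∎) (proj₂ result v (X⊆Z Xv))

-- Patterns on three edges.

·-+ : ∀ b x y → b · (x + y) ≡ b · x + b · y
·-+ true x y = refl
·-+ false x y = refl

-- Up to complement there are four patterns; P contains the constant one or else all the others.
common-pattern : {P Q : Bool → Bool → Bool → Set} →
  (∀ {x y z} → P x y z → P (not x) (not y) (not z)) → (∀ {x y z} → Q x y z → Q (not x) (not y) (not z)) →
  (∃[ x ] ∃[ y ] P x x y) → (∃[ x ] ∃[ y ] P x y x) → (∃[ x ] ∃[ y ] P y x x) →
  (∃[ x ] ∃[ y ] Q x x y) → (∃[ x ] ∃[ y ] Q x y x) → (∃[ x ] ∃[ y ] Q y x x) →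
  (∃[ x ] ∃[ y ] ∃[ z ] (P x y z × ¬ (x ≡ y × y ≡ z))) → (∃[ x ] ∃[ y ] ∃[ z ] (Q x y z × ¬ (x ≡ y × y ≡ z))) →
  ∃[ x ] ∃[ y ] ∃[ z ] (P x y z × Q x y z)
common-pattern {P} {Q} notP notQ P₁ P₂ P₃ Q₁ Q₂ Q₃ P₄ Q₄ with split notP P₁ P₂ P₃ | split notQ Q₁ Q₂ Q₃
  where
  split : {R : Bool → Bool → Bool → Set} → (∀ {x y z} → R x y z → R (not x) (not y) (not z)) →
    (∃[ x ] ∃[ y ] R x x y) → (∃[ x ] ∃[ y ] R x y x) → (∃[ x ] ∃[ y ] R y x x) →
    R false false false ⊎ (∀ x y z → ¬ (x ≡ y × y ≡ z) → R x y z)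
  split {R} notR R₁ R₂ R₃ = combine (norm₁ R₁) (norm₂ R₂) (norm₃ R₃)
    where
    -- Complementing if need be, the repeated value is `false`.
    norm₁ : (∃[ x ] ∃[ y ] R x x y) → R false false false ⊎ R false false true
    norm₁ (false , false , r) = inj₁ r
    norm₁ (false , true , r) = inj₂ r
    norm₁ (true , false , r) = inj₂ (notR r)
    norm₁ (true , true , r) = inj₁ (notR r)
    norm₂ : (∃[ x ] ∃[ y ] R x y x) → R false false false ⊎ R false true false
    norm₂ (false , false , r) = inj₁ r
    norm₂ (false , true , r) = inj₂ r
    norm₂ (true , false , r) = inj₂ (notR r)
    norm₂ (true , true , r) = inj₁ (notR r)
    norm₃ : (∃[ x ] ∃[ y ] R y x x) → R false false false ⊎ R true false false
    norm₃ (false , false , r) = inj₁ r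
    norm₃ (false , true , r) = inj₂ r
    norm₃ (true , false , r) = inj₂ (notR r)
    norm₃ (true , true , r) = inj₁ (notR r)
    combine : R false false false ⊎ R false false true → R false false false ⊎ R false true false →
              R false false false ⊎ R true false false →
              R false false false ⊎ (∀ x y z → ¬ (x ≡ y × y ≡ z) → R x y z)
    combine (inj₁ r) _ _ = inj₁ r
    combine _ (inj₁ r) _ = inj₁ r
    combine _ _ (inj₁ r) = inj₁ r
    combine (inj₂ r) (inj₂ s) (inj₂ t) = inj₂ λ
      { false false true _ → r
      ; true true false _ → notR r
      ; false true false _ → s
      ; true false true _ → notR s
      ; true false false _ → t
      ; false true true _ → notR t
      ; true true true q → contradiction (refl , refl) q
      ; false false false q → contradiction (refl , refl) q }
... | inj₁ p | inj₁ q = _ , _ , _ , p , q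
... | inj₂ p | _ = let (x , y , z , q , ne) = Q₄ in x , y , z , p x y z ne , q
... | _ | inj₂ q = let (x , y , z , p , ne) = P₄ in x , y , z , p , q x y z ne

-- Three equal labels and the label `w` of the loop would give the gadget vertex degree 0, 2, 3 or
-- 5.
star-pattern : ∀ x y z w → Is41 (x · 1 + (y · 1 + (z · 1 + w · 2))) → ¬ (x ≡ y × y ≡ z)
star-pattern true _ _ true (inj₁ ()) (refl , refl)
star-pattern true _ _ true (inj₂ ()) (refl , refl)
star-pattern true _ _ false (inj₁ ()) (refl , refl)
star-pattern true _ _ false (inj₂ ()) (refl , refl)
star-pattern false _ _ true (inj₁ ()) (refl , refl)
star-pattern false _ _ true (inj₂ ()) (refl , refl)
star-pattern false _ _ false (inj₁ ()) (refl , refl)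
star-pattern false _ _ false (inj₂ ()) (refl , refl)

count<size : (X : VSet k) {v : Fin k} → X v ≡ false → count X < k
count<size {k} X {v} q = subst (count X <_) (count-not X)
  (m<m+n (count X) (member⇒count>0 (not ∘ X) v (cong not q)))

-- Gadgets and the exclusion of small cuts.

module Minimal (en : Fin l → Fin k × Fin k) where
  open Cuts en

  module _ (regular : ∀ v → deg (λ _ → true) v ≡ 5)
           (smaller : ∀ H → n H < k → Regular 5 H → Has41Factor H) where

    open Regular5 regular
    open Surgery smaller

    module Gadget (X : VSet k) (E : Enum (cut X) c) where

      x : Fin c → Fin k
      x i = inner X (emb E i)

      Xx : ∀ i → X (x i) ≡ true
      Xx i = inner∈ X (emb-mem E i)

      realize₀ : c ≡ 0 → count X < k → ∀ p → Realizes X E p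
      realize₀ refl X<k p = proj₂ (proj₂ result) p (λ v _ → trans (∑₀ _) (sym (∑₀ _)))
        where
        result = surgery X E ⟨⟩ X X<k (λ q → q) (λ ()) (λ v _ → trans (∑₀ _) (sym (∑₀ _)))
                 (λ v p q → ⊥-elim (true≢false p q))

      -- The gadget vertex `z` is borrowed from the other side; the bound leaves at least two
      -- vertices there, so that the new graph is smaller.
      module AddVertex (z : Fin k) (Xz : X z ≡ false) (X<k : suc (count X) < k) where

        Z : VSet k
        Z v = X v ∨ (z == v)

        Z<k : count Z < k
        Z<k = ≤-<-trans (≤-trans (count-∨ X (z ==_)) (≤-reflexive
                (trans (cong (count X +_) (count-singleton z)) (+-comm (count X) 1)))) X<k

        X⊆Z : ∀ {v} → X v ≡ true → Z v ≡ true
        X⊆Z q rewrite q = refl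

        Zz : Z z ≡ true
        Zz rewrite Xz = ==-refl z

        z≠ : ∀ {v} → X v ≡ true → (z == v) ≡ false
        z≠ {v} Xv = trans (==-sym z v) (==-separates X Xv Xz)

        x≠z : ∀ i → (x i == z) ≡ false
        x≠z i = ==-separates X (Xx i) Xz

        onlyZ : ∀ {v} → Z v ≡ true → X v ≡ false → z ≡ v
        onlyZ {v} Zv Xv rewrite Xv = ==⇒≡ Zv

        Zx : ∀ i → Z (x i) ≡ true
        Zx i = X⊆Z (Xx i)

    open Gadget

    realize₁ : (X : VSet k) (E : Enum (cut X) 1) (z : Fin k) → X z ≡ false → suc (count X) < k →
               ∃[ b ] Realizes X E (b ▹ ⟨⟩)
    realize₁ X E z Xz X<k = Fx 0F , proj₂ (proj₂ result) _ λ v Xv →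
        trans (∑₁ _) (trans (sym (weighted (z≠ Xv) (Fx 0F) (Fx 1F) (Fx 2F) _)) (sym (∑₃ _)))
      where
      open AddVertex X E z Xz X<k
      x₀ = x X E 0F
      weighted : ∀ {b} → b ≡ false → ∀ f g h p →
                 f · (p + ⟦ b ⟧) + (g · (⟦ b ⟧ + ⟦ b ⟧) + h · (⟦ b ⟧ + ⟦ b ⟧)) ≡ f · p
      weighted refl f g h p rewrite ·0 g | ·0 h | +-identityʳ p = +-identityʳ _
      extra : Fin 3 → Fin k × Fin k
      extra = (x₀ , z) ▹ (z , z) ▹ (z , z) ▹ ⟨⟩
      at-z : ∑ (λ i → incidence z (extra i)) ≡ 5
      at-z = trans (∑₃ _) (lemma (x≠z 0F) (==-refl z))
        where
        lemma : ∀ {a b} → a ≡ false → b ≡ true → (⟦ a ⟧ + ⟦ b ⟧) + ((⟦ b ⟧ + ⟦ b ⟧) + (⟦ b ⟧ + ⟦ b ⟧)) ≡ 5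
        lemma refl refl = refl
      result = surgery X E extra Z Z<k X⊆Z (λ { 0F → Zx 0F , Zz ; 1F → Zz , Zz ; 2F → Zz , Zz })
        (λ v Xv → trans (∑₃ _) (trans (weighted (z≠ Xv) true true true _) (sym (∑₁ _))))
        (λ v Zv Xv → subst (λ v → ∑ (λ i → incidence v (extra i)) ≡ 5) (onlyZ Zv Xv) at-z)
      Fx = proj₁ result

    -- The edge that joins the two inner ends has one label, which both cut edges inherit. If these
    -- ends coincide it is a loop, and the degrees still agree.
    realize₂ : (X : VSet k) (E : Enum (cut X) 2) → count X < k → ∃[ b ] Realizes X E (b ▹ b ▹ ⟨⟩)
    realize₂ X E X<k = Fx 0F , proj₂ (proj₂ result) _ λ v Xv →
        trans (∑₂ _) (trans (sym (·-+ (Fx 0F) _ _)) (sym (∑₁ _)))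
      where
      result = surgery X E ((x X E 0F , x X E 1F) ▹ ⟨⟩) X X<k (λ q → q) (λ { 0F → Xx X E 0F , Xx X E 1F })
        (λ v Xv → trans (∑₁ _) (sym (∑₂ _))) (λ v p q → ⊥-elim (true≢false p q))
      Fx = proj₁ result

    -- Three cut edges and a loop give `z` degree 5. The degree of `z` in the factor is what rules
    -- out a constant pattern.
    realize₃-star : (X : VSet k) (E : Enum (cut X) 3) (z : Fin k) → X z ≡ false → suc (count X) < k →
                    ∃[ b₀ ] ∃[ b₁ ] ∃[ b₂ ] (Realizes X E (b₀ ▹ b₁ ▹ b₂ ▹ ⟨⟩) × ¬ (b₀ ≡ b₁ × b₁ ≡ b₂))
    realize₃-star X E z Xz X<k = Fx 0F , Fx 1F , Fx 2F ,
        proj₂ (proj₂ result) _ (λ v Xv → trans (∑₃ _)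
          (trans (sym (weighted (z≠ Xv) (Fx 0F) (Fx 1F) (Fx 2F) (Fx 3F) _ _ _)) (sym (∑₄ _)))) ,
        star-pattern (Fx 0F) (Fx 1F) (Fx 2F) (Fx 3F)
          (subst Is41 (trans (∑₄ _) (at-z Fx)) (proj₁ (proj₂ result) z Zz Xz))
      where
      open AddVertex X E z Xz X<k
      weighted : ∀ {b} → b ≡ false → ∀ f g h w p q r →
                 f · (p + ⟦ b ⟧) + (g · (q + ⟦ b ⟧) + (h · (r + ⟦ b ⟧) + w · (⟦ b ⟧ + ⟦ b ⟧))) ≡ f · p + (g · q + h · r)
      weighted refl f g h w p q r rewrite ·0 w | +-identityʳ p | +-identityʳ q | +-identityʳ r | +-identityʳ (h · r) = refl
      extra : Fin 4 → Fin k × Fin k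
      extra = (x X E 0F , z) ▹ (x X E 1F , z) ▹ (x X E 2F , z) ▹ (z , z) ▹ ⟨⟩
      at-z : ∀ (f : Fin 4 → Bool) → f 0F · incidence z (extra 0F) + (f 1F · incidence z (extra 1F) +
               (f 2F · incidence z (extra 2F) + f 3F · incidence z (extra 3F)))
             ≡ f 0F · 1 + (f 1F · 1 + (f 2F · 1 + f 3F · 2))
      at-z f rewrite x≠z 0F | x≠z 1F | x≠z 2F | ==-refl z = refl
      result = surgery X E extra Z Z<k X⊆Z (λ { 0F → Zx 0F , Zz ; 1F → Zx 1F , Zz ; 2F → Zx 2F , Zz ; 3F → Zz , Zz })
        (λ v Xv → trans (∑₄ _) (trans (weighted (z≠ Xv) true true true true ⟦ x X E 0F == v ⟧ ⟦ x X E 1F == v ⟧ ⟦ x X E 2F == v ⟧) (sym (∑₃ _))))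
        (λ v Zv Xv → subst (λ v → ∑ (λ i → incidence v (extra i)) ≡ 5) (onlyZ Zv Xv)
          (trans (∑₄ _) (at-z (λ _ → true))))
      Fx = proj₁ result

    -- The first two cut edges become one edge and so share a label; the third ends in `z`, which
    -- two loops bring to degree 5.
    realize₃-merge : (X : VSet k) (E : Enum (cut X) 3) (z : Fin k) → X z ≡ false → suc (count X) < k →
                     ∃[ b ] ∃[ b′ ] Realizes X E (b ▹ b ▹ b′ ▹ ⟨⟩)
    realize₃-merge X E z Xz X<k = Fx 0F , Fx 1F ,
        proj₂ (proj₂ result) _ (λ v Xv → trans (∑₃ _)
          (trans (sym (weighted (z≠ Xv) (Fx 0F) (Fx 1F) (Fx 2F) (Fx 3F) _ _ _)) (sym (∑₄ _))))
      where
      open AddVertex X E z Xz X<k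
      weighted : ∀ {b} → b ≡ false → ∀ f g h w p q r →
                 f · (p + q) + (g · (r + ⟦ b ⟧) + (h · (⟦ b ⟧ + ⟦ b ⟧) + w · (⟦ b ⟧ + ⟦ b ⟧))) ≡ f · p + (f · q + g · r)
      weighted refl f g h w p q r rewrite ·0 w | ·0 h | +-identityʳ r | +-identityʳ (g · r) | ·-+ f p q =
        +-assoc (f · p) _ _
      extra : Fin 4 → Fin k × Fin k
      extra = (x X E 0F , x X E 1F) ▹ (x X E 2F , z) ▹ (z , z) ▹ (z , z) ▹ ⟨⟩
      at-z : incidence z (extra 0F) + (incidence z (extra 1F) + (incidence z (extra 2F) + incidence z (extra 3F))) ≡ 5
      at-z rewrite x≠z 0F | x≠z 1F | x≠z 2F | ==-refl z = refl
      result = surgery X E extra Z Z<k X⊆Z (λ { 0F → Zx 0F , Zx 1F ; 1F → Zx 2F , Zz ; 2F → Zz , Zz ; 3F → Zz , Zz })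
        (λ v Xv → trans (∑₄ _) (trans (weighted (z≠ Xv) true true true true ⟦ x X E 0F == v ⟧ ⟦ x X E 1F == v ⟧ ⟦ x X E 2F == v ⟧) (sym (∑₃ _))))
        (λ v Zv Xv → subst (λ v → ∑ (λ i → incidence v (extra i)) ≡ 5) (onlyZ Zv Xv) (trans (∑₄ _) at-z))
      Fx = proj₁ result

    module _ (no-factor : ¬ (∃[ F ] (∀ v → Is41 (deg F v)))) where

      no-cut₀ : (X : VSet k) → count (cut X) ≡ 0 → ∀ {u v} → X u ≡ true → X v ≡ false → ⊥
      no-cut₀ X q Xu Xv = no-factor (realizes-glue X E {p = ⟨⟩}
          (realize₀ X E refl (count<size X Xv) ⟨⟩)
          (realize₀ (not ∘ X) (Enum-cong (cut-not X) E) refl (count<size (not ∘ X) (cong not Xu)) ⟨⟩))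
        where E = enumOf (cut X) q

      -- The two patterns on one edge are complements of each other, so each side realizes `false`.
      no-cut₁ : (X : VSet k) → count (cut X) ≡ 1 → suc (count X) < k → suc (count (not ∘ X)) < k → ⊥
      no-cut₁ X q X<k Y<k = no-factor (realizes-glue X E
          (normalize X E (realize₁ X E _ (outer∉ X (emb-mem E 0F)) X<k))
          (normalize (not ∘ X) E′ (realize₁ (not ∘ X) E′ _ (cong not (inner∈ X (emb-mem E 0F))) Y<k)))
        where
        E = enumOf (cut X) q
        E′ = Enum-cong (cut-not X) E
        normalize : ∀ X (E : Enum (cut X) 1) → ∃[ b ] Realizes X E (b ▹ ⟨⟩) → Realizes X E (false ▹ ⟨⟩)
        normalize X E (false , r) = r
        normalize X E (true , r) = Realizes-cong X E (λ { 0F → refl }) (Realizes-not X E r)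

      -- A cut edge has an end on either side, so dropping a side already makes the graph smaller.
      -- Both sides realize a constant pattern, normalized to `false`.
      no-cut₂ : (X : VSet k) → count (cut X) ≡ 2 → ⊥
      no-cut₂ X q = no-factor (realizes-glue X E
          (normalize X E (realize₂ X E (count<size X (outer∉ X (emb-mem E 0F)))))
          (normalize (not ∘ X) E′ (realize₂ (not ∘ X) E′ (count<size (not ∘ X) (cong not (inner∈ X (emb-mem E 0F)))))))
        where
        E = enumOf (cut X) q
        E′ = Enum-cong (cut-not X) E
        normalize : ∀ X (E : Enum (cut X) 2) → ∃[ b ] Realizes X E (b ▹ b ▹ ⟨⟩) → Realizes X E (false ▹ false ▹ ⟨⟩)
        normalize X E (false , r) = r
        normalize X E (true , r) = Realizes-cong X E (λ { 0F → refl ; 1F → refl }) (Realizes-not X E r)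

      no-cut₃ : (X : VSet k) → count (cut X) ≡ 3 → suc (count X) < k → suc (count (not ∘ X)) < k → ⊥
      no-cut₃ X q X<k Y<k =
        let (_ , _ , _ , P , Q) = common-pattern (complement X E) (complement (not ∘ X) E′)
              (realize₃-merge X E _ z∉ X<k) (merge₀₂ X E z∉ X<k) (merge₁₂ X E z∉ X<k)
              (realize₃-merge (not ∘ X) E′ _ z∉′ Y<k) (merge₀₂ (not ∘ X) E′ z∉′ Y<k) (merge₁₂ (not ∘ X) E′ z∉′ Y<k)
              (realize₃-star X E _ z∉ X<k) (realize₃-star (not ∘ X) E′ _ z∉′ Y<k)
        in no-factor (realizes-glue X E P Q)
        where
        E = enumOf (cut X) q
        E′ = Enum-cong (cut-not X) E
        z∉ = outer∉ X (emb-mem E 0F)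
        z∉′ = cong not (inner∈ X (emb-mem E 0F))
        complement : ∀ X (E : Enum (cut X) 3) {x y z} → Realizes X E (x ▹ y ▹ z ▹ ⟨⟩) →
                     Realizes X E (not x ▹ not y ▹ not z ▹ ⟨⟩)
        complement X E r = Realizes-cong X E (λ { 0F → refl ; 1F → refl ; 2F → refl }) (Realizes-not X E r)
        merge₀₂ : ∀ X (E : Enum (cut X) 3) {z} → X z ≡ false → suc (count X) < k →
                  ∃[ x ] ∃[ y ] Realizes X E (x ▹ y ▹ x ▹ ⟨⟩)
        -- With the last two edges exchanged, the merged pair consists of the edges 0 and 2.
        merge₀₂ X E Xz X<k with realize₃-merge X (Enum-permute (transpose 1F 2F) E) _ Xz X<k
        ... | x , y , F , real , F-emb = x , y , F , real , λ { 0F → F-emb 0F ; 1F → F-emb 2F ; 2F → F-emb 1F }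
        merge₁₂ : ∀ X (E : Enum (cut X) 3) {z} → X z ≡ false → suc (count X) < k →
                  ∃[ x ] ∃[ y ] Realizes X E (y ▹ x ▹ x ▹ ⟨⟩)
        merge₁₂ X E Xz X<k with realize₃-merge X (Enum-permute (transpose 0F 2F) E) _ Xz X<k
        ... | x , y , F , real , F-emb = x , y , F , real , λ { 0F → F-emb 2F ; 1F → F-emb 1F ; 2F → F-emb 0F }

-- Calculus of vertex sets.

∧-true : ∀ {x y} → x ∧ y ≡ true → x ≡ true × y ≡ true
∧-true {true} {true} _ = refl , refl

∨-true : ∀ {x y} → x ∨ y ≡ true → x ≡ true ⊎ y ≡ true
∨-true {true} _ = inj₁ refl
∨-true {false} q = inj₂ q

∨-trueˡ : ∀ {x y} → x ≡ true → x ∨ y ≡ true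
∨-trueˡ refl = refl

∨-trueʳ : ∀ {x y} → y ≡ true → x ∨ y ≡ true
∨-trueʳ {true} _ = refl
∨-trueʳ {false} q = q

xor≡false⇒≡ : ∀ {x y} → x xor y ≡ false → x ≡ y
xor≡false⇒≡ {true} {true} _ = refl
xor≡false⇒≡ {false} {false} _ = refl

bool-cases : ∀ b → b ≡ true ⊎ b ≡ false
bool-cases true = inj₁ refl
bool-cases false = inj₂ refl

infix 4 _⊆_
_⊆_ : VSet k → VSet k → Set
p ⊆ q = ∀ i → p i ≡ true → q i ≡ true

infixl 6 _∖_
_∖_ : VSet k → VSet k → VSet k
(p ∖ q) i = p i ∧ not (q i)

∈∖⇒ : ∀ {p q : VSet k} {i} → (p ∖ q) i ≡ true → p i ≡ true × q i ≡ false
∈∖⇒ {p = p} {q} {i} h with p i | q i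
... | true | false = refl , refl

⇒∈∖ : ∀ {p q : VSet k} {i} → p i ≡ true → q i ≡ false → (p ∖ q) i ≡ true
⇒∈∖ a b rewrite a | b = refl

infixr 6 _∪_
_∪_ : VSet k → VSet k → VSet k
(p ∪ q) i = p i ∨ q i

⟦∖⟧ : ∀ {p q : VSet k} → q ⊆ p → ∀ i → ⟦ (p ∖ q) i ⟧ + ⟦ q i ⟧ ≡ ⟦ p i ⟧
⟦∖⟧ {p = p} {q} q⊆p i with p i | q i | q⊆p i
... | true | true | _ = refl
... | true | false | _ = refl
... | false | false | _ = refl
... | false | true | h = contradiction (h refl) λ ()

count-∖ : ∀ {p q : VSet k} → q ⊆ p → count (p ∖ q) + count q ≡ count p
count-∖ q⊆p = trans (sym (∑-+ _ _)) (∑-cong (⟦∖⟧ q⊆p))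

count-⊆ : ∀ {p q : VSet k} → p ⊆ q → count p ≤ count q
count-⊆ {q = q} p⊆q = ≤-trans (m≤n+m _ _) (≤-reflexive (count-∖ p⊆q))

count-disjoint-∪ : (p q : VSet k) → (∀ i → p i ≡ true → q i ≡ false) → count p + count q ≡ count (p ∪ q)
count-disjoint-∪ p q disjoint = trans (sym (∑-+ _ _)) (∑-cong pointwise)
  where
  pointwise : ∀ i → ⟦ p i ⟧ + ⟦ q i ⟧ ≡ ⟦ p i ∨ q i ⟧
  pointwise i with p i | q i | disjoint i
  ... | true | false | _ = refl
  ... | true | true | h = contradiction (h refl) λ ()
  ... | false | _ | _ = refl

singleton-⊆ : {p : VSet k} {i : Fin k} → p i ≡ true → (i ==_) ⊆ p
singleton-⊆ {p = p} pi j i==j = subst (λ j → p j ≡ true) (==⇒≡ i==j) pi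

count-remove : (p : VSet k) {i : Fin k} → p i ≡ true → suc (count (p ∖ (i ==_))) ≡ count p
count-remove p {i} pi = trans (+-comm 1 _) (trans (cong (count (p ∖ (i ==_)) +_) (sym (count-singleton i)))
                        (count-∖ (singleton-⊆ {p = p} pi)))

count≤1 : (p : VSet k) → (∀ i i′ → p i ≡ true → p i′ ≡ true → i ≡ i′) → count p ≤ 1
count≤1 p unique with 1 ≤? count p
... | no ¬1≤ = ≤-trans (≤-pred (≰⇒> ¬1≤)) z≤n
... | yes 1≤ with count>0⇒member p 1≤
... | i , pi = ≤-trans (count-⊆ λ i′ pi′ → trans (cong (i ==_) (sym (unique i i′ pi pi′))) (==-refl i))
                       (≤-reflexive (count-singleton i))

-- Hall's theorem, up to double negation.

module Hall (R : Fin r → Fin k → Set) (default : Fin k) where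

  Closed : VSet r → VSet k → VSet k → Set
  Closed J T T′ = ∀ i s → J i ≡ true → T s ≡ true → R i s → T′ s ≡ true

  -- T′ only has to contain the neighbourhood of J′, so that neighbourhoods need not be decidable.
  HallCondition : VSet r → VSet k → Set
  HallCondition J T = ∀ J′ T′ → J′ ⊆ J → T′ ⊆ T → Closed J′ T T′ → count J′ ≤ count T′

  Saturating : VSet r → VSet k → Set
  Saturating J T = Σ[ g ∈ (Fin r → Fin k) ]
    ((∀ i → J i ≡ true → T (g i) ≡ true × R i (g i)) ×
     (∀ i i′ → J i ≡ true → J i′ ≡ true → g i ≡ g i′ → i ≡ i′))

  -- A nonempty proper part of `J` whose neighbourhood in `T` fits into a `T′` of no larger size.
  -- The induction splits `J` along such a part.
  Critical : VSet r → VSet k → Set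
  Critical J T = Σ[ J′ ∈ VSet r ] Σ[ T′ ∈ VSet k ] (J′ ⊆ J × T′ ⊆ T × Closed J′ T T′ ×
    1 ≤ count J′ × count J′ < count J × count T′ ≤ count J′)

  hall-inner : ∀ {J T} ((J′ , T′ , _) : Critical J T) → HallCondition J T → HallCondition J′ T′
  hall-inner (J′ , T′ , J′⊆J , T′⊆T , closed , _) hall J″ T″ J″⊆J′ T″⊆T′ closed″ =
    hall J″ T″ (λ i → J′⊆J i ∘ J″⊆J′ i) (λ s → T′⊆T s ∘ T″⊆T′ s)
      (λ i s J″i Ts Ris → closed″ i s J″i (closed i s (J″⊆J′ i J″i) Ts Ris) Ris)

  -- The condition is applied to `J″ ∪ J′`, whose neighbourhood lies in `T″ ∪ T′`; then `J′` cancels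
  -- against `T′`, which is no larger.
  hall-outer : ∀ {J T} ((J′ , T′ , _) : Critical J T) → HallCondition J T → HallCondition (J ∖ J′) (T ∖ T′)
  hall-outer {J} {T} (J′ , T′ , J′⊆J , T′⊆T , closed , _ , _ , T′≤J′) hall J″ T″ J″⊆ T″⊆ closed″ =
    +-cancelʳ-≤ (count J′) _ _ (begin
      count J″ + count J′ ≡⟨ count-disjoint-∪ J″ J′ (λ i q → proj₂ (∈∖⇒ {p = J} {J′} (J″⊆ i q))) ⟩
      count (J″ ∪ J′) ≤⟨ hall _ _ J⊆ T⊆ closed-∪ ⟩
      count (T″ ∪ T′) ≤⟨ count-∨ T″ T′ ⟩
      count T″ + count T′ ≤⟨ +-monoʳ-≤ (count T″) T′≤J′ ⟩
      count T″ + count J′ ∎)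
    where
    open ≤-Reasoning
    J⊆ : J″ ∪ J′ ⊆ J
    J⊆ i q with ∨-true {J″ i} q
    ... | inj₁ h = proj₁ (∈∖⇒ {p = J} {J′} (J″⊆ i h))
    ... | inj₂ h = J′⊆J i h
    T⊆ : T″ ∪ T′ ⊆ T
    T⊆ i q with ∨-true {T″ i} q
    ... | inj₁ h = proj₁ (∈∖⇒ {p = T} {T′} (T″⊆ i h))
    ... | inj₂ h = T′⊆T i h
    closed-∪ : Closed (J″ ∪ J′) T (T″ ∪ T′)
    closed-∪ i s q Ts Ris with ∨-true {J″ i} q | bool-cases (T′ s)
    ... | _ | inj₁ h = ∨-trueʳ {T″ s} h
    ... | inj₂ h | _ = ∨-trueʳ {T″ s} (closed i s h Ts Ris)
    ... | inj₁ h | inj₂ ¬T′s = ∨-trueˡ (closed″ i s h (⇒∈∖ {p = T} {T′} Ts ¬T′s) Ris)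

  saturating-∪ : ∀ {J T J′ T′} → T′ ⊆ T → Saturating J′ T′ → Saturating (J ∖ J′) (T ∖ T′) → Saturating J T
  saturating-∪ {J} {T} {J′} {T′} T′⊆T (g₁ , good₁ , inj-g₁) (g₂ , good₂ , inj-g₂) = g , good , inj-g
    where
    g : Fin r → Fin k
    g i = if J′ i then g₁ i else g₂ i
    good : ∀ i → J i ≡ true → T (g i) ≡ true × R i (g i)
    good i Ji with J′ i in eq
    ... | true = T′⊆T _ (proj₁ (good₁ i eq)) , proj₂ (good₁ i eq)
    ... | false = let (Tg , Rg) = good₂ i (⇒∈∖ {p = J} {J′} Ji eq) in proj₁ (∈∖⇒ {p = T} {T′} Tg) , Rg
    separate : ∀ i i′ → J′ i ≡ true → J i′ ≡ true → J′ i′ ≡ false → g₁ i ≢ g₂ i′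
    separate i i′ J′i Ji′ ¬J′i′ q = true≢false (subst (λ s → T′ s ≡ true) q (proj₁ (good₁ i J′i)))
      (proj₂ (∈∖⇒ {p = T} {T′} (proj₁ (good₂ i′ (⇒∈∖ {p = J} {J′} Ji′ ¬J′i′)))))
    inj-g : ∀ i i′ → J i ≡ true → J i′ ≡ true → g i ≡ g i′ → i ≡ i′
    inj-g i i′ Ji Ji′ q with J′ i in eq | J′ i′ in eq′
    ... | true | true = inj-g₁ i i′ eq eq′ q
    ... | true | false = contradiction q (separate i i′ eq Ji′ eq′)
    ... | false | true = contradiction (sym q) (separate i′ i eq′ Ji eq)
    ... | false | false = inj-g₂ i i′ (⇒∈∖ {p = J} {J′} Ji eq) (⇒∈∖ {p = J} {J′} Ji′ eq′) q

  saturating-single : ∀ {i s} → R i s → Saturating (i ==_) (s ==_)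
  saturating-single {i} {s} Ris = (λ _ → s) ,
    (λ i′ q → ==-refl s , subst (λ i → R i s) (==⇒≡ q) Ris) ,
    (λ _ _ q q′ _ → trans (sym (==⇒≡ q)) (==⇒≡ q′))

  -- A violating `J″` has more elements than `T″`, so it becomes critical in `J` once `s` is put
  -- back into `T″`.
  hall-remove : ∀ {J T i s} → J i ≡ true → T s ≡ true → ¬ Critical J T → HallCondition (J ∖ (i ==_)) (T ∖ (s ==_))
  hall-remove {J} {T} {i} {s} Ji Ts ¬critical J″ T″ J″⊆ T″⊆ closed″ with count J″ ≤? count T″
  ... | yes q = q
  ... | no q = contradiction (J″ , T″ ∪ (s ==_) ,
      (λ i′ h → proj₁ (∈∖⇒ {p = J} {i ==_} (J″⊆ i′ h))) , T⊆ , closed-∪ ,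
      ≤-trans (s≤s z≤n) T″<J″ ,
      ≤-trans (s≤s (count-⊆ J″⊆)) (≤-reflexive (count-remove J Ji)) ,
      ≤-trans (count-∨ T″ (s ==_)) (≤-trans (≤-reflexive (trans (cong (count T″ +_) (count-singleton s)) (+-comm _ 1))) T″<J″))
      ¬critical
    where
    T″<J″ : count T″ < count J″
    T″<J″ = ≰⇒> q
    T⊆ : T″ ∪ (s ==_) ⊆ T
    T⊆ t h with ∨-true {T″ t} h
    ... | inj₁ h′ = proj₁ (∈∖⇒ {p = T} {s ==_} (T″⊆ t h′))
    ... | inj₂ h′ = subst (λ t → T t ≡ true) (==⇒≡ h′) Ts
    closed-∪ : Closed J″ T (T″ ∪ (s ==_))
    closed-∪ i′ t J″i Tt R with bool-cases (s == t)
    ... | inj₁ h = ∨-trueʳ {T″ t} h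
    ... | inj₂ h = ∨-trueˡ (closed″ i′ t J″i (⇒∈∖ {p = T} {s ==_} Tt h) R)

  -- The induction of Halmos and Vaughan: split along a critical part if there is one, otherwise
  -- match any element with any of its neighbours. Existence of a critical part is not decided,
  -- hence the double negation.
  hall′ : ∀ fuel J T → count J < fuel → HallCondition J T → ¬ ¬ Saturating J T
  hall′ (suc fuel) J T (s≤s J≤) hall ¬sat with 1 ≤? count J
  -- The map is total while `J` is empty, so any value will do.
  ... | no empty = ¬sat ((λ _ → default) , (λ i Ji → ⊥-elim (absurd Ji)) , (λ i _ Ji → ⊥-elim (absurd Ji)))
    where
    absurd : ∀ {i} → J i ≡ true → ⊥
    absurd {i} Ji = empty (member⇒count>0 J i Ji)
  ... | yes nonempty = ¬¬-excluded-middle {A = Critical J T} λ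
    { (yes critical@(J′ , T′ , J′⊆J , T′⊆T , closed , 1≤J′ , J′<J , T′≤J′)) →
        hall′ fuel J′ T′ (≤-trans J′<J J≤) (hall-inner critical hall) λ sat₁ →
        hall′ fuel (J ∖ J′) (T ∖ T′)
          (≤-trans (≤-trans (≤-trans (≤-reflexive (+-comm 1 _)) (+-monoʳ-≤ (count (J ∖ J′)) 1≤J′)) (≤-reflexive (count-∖ J′⊆J))) J≤)
          (hall-outer critical hall) λ sat₂ →
        ¬sat (saturating-∪ {J = J} {J′ = J′} T′⊆T sat₁ sat₂)
    ; (no ¬critical) → let (i , Ji) = count>0⇒member J nonempty in ¬¬-excluded-middle {A = Σ[ s ∈ Fin k ] (T s ≡ true × R i s)} λ
        { (yes (s , Ts , Ris)) →
            hall′ fuel (J ∖ (i ==_)) (T ∖ (s ==_)) (≤-trans (≤-reflexive (count-remove J Ji)) J≤)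
              (hall-remove Ji Ts ¬critical) λ sat →
            ¬sat (saturating-∪ {J = J} {J′ = i ==_} (singleton-⊆ Ts) (saturating-single Ris) sat)
        -- An element without neighbours violates the condition, with `T′` empty.
        ; (no isolated) → contradiction
            (hall (i ==_) (λ _ → false) (singleton-⊆ Ji) (λ _ ())
              (λ i′ s q Ts Ris → contradiction (s , Ts , subst (λ i → R i s) (sym (==⇒≡ q)) Ris) isolated))
            (<⇒≱ (≤-reflexive (trans (cong suc (∑-zero λ _ → refl)) (sym (count-singleton i))))) } }

  hall : (J : VSet r) (T : VSet k) → HallCondition J T → ¬ ¬ Saturating J T
  hall J T = hall′ _ J T ≤-refl

-- Parity, with `true` for odd numbers.

par : ℕ → Bool
par zero = false
par (suc x) = not (par x)

par-+ : ∀ x y → par (x + y) ≡ par x xor par y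
par-+ zero y = refl
par-+ (suc x) y rewrite par-+ x y = not-xor (par x) (par y)
  where
  not-xor : ∀ a b → not (a xor b) ≡ not a xor b
  not-xor true true = refl
  not-xor true false = refl
  not-xor false b = refl

par-∑-odd : (f : Fin r → ℕ) → (∀ i → par (f i) ≡ true) → par (∑ f) ≡ par r
par-∑-odd {zero} f odd = cong par (∑₀ f)
par-∑-odd {suc r} f odd rewrite ∑-suc f | par-+ (f zero) (∑ (f ∘ suc)) | odd zero | par-∑-odd (f ∘ suc) (odd ∘ suc) = refl

same-parity-gap : ∀ {x y} → x < y → par x ≡ par y → 2 + x ≤ y
same-parity-gap {x} {y} x<y eq with m≤n⇒m<n∨m≡n x<y
... | inj₁ q = q
... | inj₂ refl = contradiction eq (lemma (par x))
  where
  lemma : ∀ b → b ≢ not b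
  lemma true ()
  lemma false ()

remainder-indicator : ∀ u t → t ≤ ⟦ u ⟧ → ⟦ u ∧ (t ≡ᵇ 0) ⟧ + t ≡ ⟦ u ⟧
remainder-indicator true zero _ = refl
remainder-indicator true (suc zero) _ = refl
remainder-indicator true (suc (suc _)) (s≤s ())
remainder-indicator false zero _ = refl

¬¬-Fin : {P : Fin r → Set} → (∀ i → ¬ ¬ P i) → ¬ ¬ (∀ i → P i)
¬¬-Fin {zero} _ h = h λ ()
¬¬-Fin {suc r} f h = f zero λ p₀ → ¬¬-Fin (f ∘ suc) λ ps → h λ { zero → p₀ ; (suc i) → ps i }

-- Tutte's theorem, up to double negation.

module Matching (en : Fin l → Fin k × Fin k) where
  open Cuts en

  Adj : Fin k → Fin k → Set
  Adj u w = ∃[ e ] (en e ≡ (u , w) ⊎ en e ≡ (w , u))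

  Adj-sym : ∀ {u w} → Adj u w → Adj w u
  Adj-sym (e , inj₁ q) = e , inj₂ q
  Adj-sym (e , inj₂ q) = e , inj₁ q

  -- For the indicator of a vertex set this is a perfect matching of the subgraph induced on it.
  -- Prescribing degrees turns unions of disjoint matchings into sums.
  Match : (Fin k → ℕ) → Set
  Match d = ∃[ F ] (∀ v → deg F v ≡ d v)

  Match-cong : ∀ {d d′} → (∀ v → d v ≡ d′ v) → Match d → Match d′
  Match-cong d≗d′ (F , degF) = F , λ v → trans (degF v) (d≗d′ v)

  Match-∅ : Match (λ _ → 0)
  Match-∅ = (λ _ → false) , λ v → ∑-zero λ _ → refl

  Match-edge : ∀ {u w} → Adj u w → Match (λ v → ⟦ u == v ⟧ + ⟦ w == v ⟧)
  Match-edge {u} {w} (e , ends) = (e ==_) , λ v → trans (∑-point (λ e → incidence v (en e)) e) (lemma v ends)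
    where
    lemma : ∀ v → en e ≡ (u , w) ⊎ en e ≡ (w , u) → incidence v (en e) ≡ ⟦ u == v ⟧ + ⟦ w == v ⟧
    lemma v (inj₁ q) rewrite q = refl
    lemma v (inj₂ q) rewrite q = +-comm ⟦ w == v ⟧ _

  -- An edge in both `F` and `F′` would give its end degree at least 1 in each, so the union is
  -- disjoint and degrees add.
  Match-+ : ∀ {d d′} → Match d → Match d′ → (∀ v → d v + d′ v ≤ 1) → Match (λ v → d v + d′ v)
  Match-+ {d} {d′} (F , degF) (F′ , degF′) d+d′≤1 = (F ∪ F′) , λ v →
      trans (∑-cong (pointwise v)) (trans (∑-+ _ _) (cong₂ _+_ (degF v) (degF′ v)))
    where
    covered : ∀ F e → F e ≡ true → 1 ≤ deg F (proj₁ (en e))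
    covered F e q = ≤-trans (lemma (F e) q (==-refl (proj₁ (en e)))) (term≤∑ (λ e′ → F e′ · incidence (proj₁ (en e)) (en e′)) e)
      where
      lemma : ∀ b {c} {x} → b ≡ true → c ≡ true → 1 ≤ b · (⟦ c ⟧ + x)
      lemma b refl refl = s≤s z≤n
    pointwise : ∀ v e → (F e ∨ F′ e) · incidence v (en e) ≡ F e · incidence v (en e) + F′ e · incidence v (en e)
    pointwise v e with F e in eq | F′ e in eq′
    ... | true | true = contradiction
      (≤-trans (+-mono-≤ (covered F e eq) (covered F′ e eq′))
        (≤-trans (≤-reflexive (cong₂ _+_ (degF _) (degF′ _))) (d+d′≤1 _))) λ { (s≤s ()) }
    ... | true | false = sym (+-identityʳ _)
    ... | false | true = refl
    ... | false | false = refl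

  Match-∑ : ∀ {d : Fin r → Fin k → ℕ} → (∀ i → Match (d i)) → (∀ v → ∑ (λ i → d i v) ≤ 1) →
            Match (λ v → ∑ (λ i → d i v))
  Match-∑ {zero} _ _ = Match-cong (λ v → sym (∑₀ _)) Match-∅
  Match-∑ {suc r} {d} matches ≤1 = Match-cong (λ v → sym (∑-suc _))
    (Match-+ (matches zero) (Match-∑ (matches ∘ suc) λ v → ≤-trans (m≤n+m _ _) (bound v)) bound)
    where
    bound : ∀ v → d zero v + ∑ (λ i → d (suc i) v) ≤ 1
    bound v = subst (_≤ 1) (∑-suc _) (≤1 v)

  -- Each class is a union of components of U − S, and has odd size: a Tutte barrier without components.
  record Packing (U : VSet k) (r : ℕ) : Set where
    field
      S        : VSet k
      C        : Fin r → VSet k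
      disjoint : ∀ v → ⟦ S v ⟧ + ∑ (λ i → ⟦ C i v ⟧) ≤ ⟦ U v ⟧
      closed   : ∀ i {u w} → Adj u w → C i u ≡ true → U w ≡ true → C i w ≡ true ⊎ S w ≡ true
      odd      : ∀ i → par (count (C i)) ≡ true

    C⊆U : ∀ i → C i ⊆ U
    C⊆U i v q = ⟦⟧-pos (≤-trans (≤-trans (≤-reflexive (sym (cong ⟦_⟧ q)))
      (term≤∑ (λ i → ⟦ C i v ⟧) i)) (≤-trans (m≤n+m _ _) (disjoint v)))

    remainder : VSet k
    remainder v = U v ∧ (⟦ S v ⟧ + ∑ (λ i → ⟦ C i v ⟧) ≡ᵇ 0)

    partition : ∀ v → ⟦ remainder v ⟧ + (⟦ S v ⟧ + ∑ (λ i → ⟦ C i v ⟧)) ≡ ⟦ U v ⟧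
    partition v = remainder-indicator (U v) _ (disjoint v)

    remainder⊆U : remainder ⊆ U
    remainder⊆U v q = proj₁ (∧-true q)

    S∌C : ∀ {i v} → S v ≡ true → C i v ≡ true → ⊥
    S∌C {i} {v} Sv Cv = contradiction (≤-trans (+-mono-≤ (≤-reflexive (sym (cong ⟦_⟧ Sv)))
      (≤-trans (≤-reflexive (sym (cong ⟦_⟧ Cv))) (term≤∑ (λ i → ⟦ C i v ⟧) i)))
      (≤-trans (disjoint v) (⟦⟧≤1 (U v)))) λ { (s≤s ()) }

    remainder-avoids : ∀ {v} → remainder v ≡ true → S v ≡ false × (∀ i → C i v ≡ false)
    remainder-avoids {v} q = ¬Sv , λ i → ⟦⟧-injective (∑≡0⇒≡0 _ (m+n≡0⇒n≡0 ⟦ S v ⟧ zero-sum) i)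
      where
      zero-sum : ⟦ S v ⟧ + ∑ (λ i → ⟦ C i v ⟧) ≡ 0
      zero-sum = n≤0⇒n≡0 (+-cancelˡ-≤ 1 _ _ (≤-trans (≤-reflexive (trans (cong (λ b → ⟦ b ⟧ + _) (sym q)) (partition v))) (⟦⟧≤1 (U v))))
      ¬Sv : S v ≡ false
      ¬Sv = ⟦⟧-injective (m+n≡0⇒m≡0 ⟦ S v ⟧ zero-sum)

    -- If `w` lay in a class, closedness of that class would put `u` into the class or into `S`.
    remainder-closed : ∀ {u w} → Adj u w → remainder u ≡ true → U w ≡ true → remainder w ≡ true ⊎ S w ≡ true
    remainder-closed {u} {w} adj Ru Uw with bool-cases (remainder w) | bool-cases (S w)
    ... | inj₁ q | _ = inj₁ q
    ... | inj₂ _ | inj₁ q = inj₂ q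
    ... | inj₂ ¬R | inj₂ ¬S with count>0⇒member (λ i → C i w) (≤-reflexive (sym in-class))
      where
      in-class : ∑ (λ i → ⟦ C i w ⟧) ≡ 1
      in-class = trans (cong₂ (λ a b → ⟦ a ⟧ + (⟦ b ⟧ + ∑ (λ i → ⟦ C i w ⟧))) (sym ¬R) (sym ¬S)) (trans (partition w) (cong ⟦_⟧ Uw))
    ... | i , Ciw with closed i (Adj-sym adj) Ciw (remainder⊆U u Ru)
    ... | inj₁ Ciu = ⊥-elim (true≢false Ciu (proj₂ (remainder-avoids Ru) i))
    ... | inj₂ Su = ⊥-elim (true≢false Su (proj₁ (remainder-avoids Ru)))

    -- The `r` odd classes contribute the parity of `r`.
    remainder-parity : par (count remainder) xor (par (count S) xor par r) ≡ par (count U)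
    remainder-parity = trans (sym expand) (cong par count-partition)
      where
      classes : ℕ
      classes = ∑ (λ i → count (C i))
      count-partition : count remainder + (count S + classes) ≡ count U
      count-partition = trans (cong (count remainder +_) (trans (cong (count S +_) (∑-swap _)) (sym (∑-+ _ _))))
        (trans (sym (∑-+ _ _)) (∑-cong partition))
      expand : par (count remainder + (count S + classes)) ≡ par (count remainder) xor (par (count S) xor par r)
      expand rewrite par-+ (count remainder) (count S + classes) | par-+ (count S) classes
                   | par-∑-odd (λ i → count (C i)) odd = refl

  open Packing

  addClass : ∀ {U} (P : Packing U r) (S′ D : VSet k) → S P ⊆ S′ →
             (∀ v → ⟦ S′ v ⟧ + (⟦ D v ⟧ + ∑ (λ i → ⟦ C P i v ⟧)) ≤ ⟦ U v ⟧) →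
             (∀ {u w} → Adj u w → D u ≡ true → U w ≡ true → D w ≡ true ⊎ S′ w ≡ true) →
             par (count D) ≡ true → Packing U (suc r)
  addClass {U = U} P S′ D S⊆S′ disjoint′ closed′ odd′ = record
    { S = S′
    ; C = D ▹ C P
    ; disjoint = λ v → ≤-trans (≤-reflexive (cong (⟦ S′ v ⟧ +_) (∑-suc _))) (disjoint′ v)
    ; closed = λ { zero → closed′ ; (suc i) adj Cu Uw → map₂ (S⊆S′ _) (closed P i adj Cu Uw) }
    ; odd = λ { zero → odd′ ; (suc i) → odd P i } }

  empty : ∀ U → Packing U 0
  empty U = record
    { S = λ _ → false ; C = ⟨⟩ ; disjoint = λ v → ≤-trans (≤-reflexive (∑₀ _)) z≤n ; closed = λ () ; odd = λ () }

  -- The usual condition on odd components: these form a packing, and conversely each odd class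
  -- contains an odd component.
  TutteCondition : VSet k → Set
  TutteCondition U = ∀ {r} (P : Packing U r) → r ≤ count (S P)

  count-∅ : count {k} (λ _ → false) ≡ 0
  count-∅ = ∑-zero λ _ → refl

  -- An odd `U` would be a single class with empty `S`.
  tutte⇒even : ∀ {U} → TutteCondition U → par (count U) ≡ false
  tutte⇒even {U} tutte with bool-cases (par (count U))
  ... | inj₂ q = q
  ... | inj₁ q = contradiction (tutte (addClass (empty U) (λ _ → false) U (λ _ r → r)
      (λ v → ≤-reflexive (trans (cong (⟦ U v ⟧ +_) (∑₀ _)) (+-identityʳ _))) (λ _ _ → inj₁) q))
    (<⇒≱ (s≤s (≤-reflexive count-∅)))

  -- If r and |S| have different parities then the remainder is one more odd class.
  excess : ∀ {U} → par (count U) ≡ false → (P : Packing U r) → count (S P) < r →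
           ∃[ r′ ] Σ[ P′ ∈ Packing U r′ ] (2 + count (S P′) ≤ r′)
  excess {r = r} {U = U} even P S<r with bool-cases (par (count (remainder P)))
  ... | inj₂ q = r , P , same-parity-gap S<r (xor≡false⇒≡ (trans (cong (_xor (par (count (S P)) xor par r)) (sym q)) (trans (remainder-parity P) even)))
  ... | inj₁ q = suc r , addClass P (S P) (remainder P) (λ _ h → h)
      (λ v → ≤-reflexive (trans (lemma ⟦ S P v ⟧ ⟦ remainder P v ⟧ _) (partition P v)))
      (remainder-closed P) q , s≤s S<r
    where
    lemma : ∀ a b c → a + (b + c) ≡ b + (a + c)
    lemma = solve-∀

  -- Under Tutte's condition this is equality.
  Tight : ∀ {U} → Packing U r → Set
  Tight {r = r} P = count (S P) ≤ r

  Maximal : ∀ {U} → Packing U r → Set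
  Maximal {r = r} {U = U} P = ∀ {r′} (P′ : Packing U r′) → Tight P′ → r′ ≤ r

  -- The empty packing is tight, and Tutte's condition bounds the number of classes by the size of
  -- `S`, hence by `k`; enlarging must stop.
  maximal-tight : ∀ {U} → TutteCondition U → ¬ ¬ (∃[ r ] Σ[ P ∈ Packing U r ] (Tight P × Maximal P))
  maximal-tight {U} tutte ¬max = search (suc k) (empty U) (≤-reflexive count-∅) ≤-refl
    where
    search : ∀ fuel (P : Packing U r) → Tight P → k < r + fuel → ⊥
    search {r} zero P tight k<r = <⇒≱ k<r (≤-trans (≤-reflexive (+-identityʳ r)) (≤-trans (tutte P) (count≤size (S P))))
    search {r} (suc fuel) P tight k<r = ¬¬-excluded-middle {A = ∃[ r′ ] Σ[ P′ ∈ Packing U r′ ] (Tight P′ × r < r′)} λ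
      { (yes (r′ , P′ , tight′ , r<r′)) → search fuel P′ tight′
          (≤-trans k<r (≤-trans (≤-reflexive (+-suc r fuel)) (+-monoˡ-≤ fuel r<r′)))
      ; (no none) → ¬max (r , P , tight , λ P′ tight′ → ≮⇒≥ λ r<r′ → none (_ , P′ , tight′ , r<r′)) }

  -- Since `U` is even and `S` has `r` elements, the remainder is even. Moving one of its vertices
  -- into `S` would leave an odd set, a further class of a tight packing.
  maximal⇒no-remainder : ∀ {U} → TutteCondition U → (P : Packing U r) → Tight P → Maximal P →
                         ∀ v → remainder P v ≡ false
  maximal⇒no-remainder {r = r} {U = U} tutte P tight maximal v with bool-cases (remainder P v)
  ... | inj₂ q = q
  ... | inj₁ Rv = contradiction (maximal (addClass P S′ D (λ w → ∨-trueˡ) disjoint′ closed′ odd′)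
        (≤-trans (count-∨ (S P) (v ==_)) (≤-trans (≤-reflexive (trans (cong (count (S P) +_) (count-singleton v)) (+-comm _ 1))) (s≤s tight))))
      (<⇒≱ ≤-refl)
    where
    S′ D : VSet k
    S′ = S P ∪ (v ==_)
    D = remainder P ∖ (v ==_)
    disjoint′ : ∀ w → ⟦ S′ w ⟧ + (⟦ D w ⟧ + ∑ (λ i → ⟦ C P i w ⟧)) ≤ ⟦ U w ⟧
    disjoint′ w = begin
      ⟦ S′ w ⟧ + (⟦ D w ⟧ + classes) ≤⟨ +-monoˡ-≤ _ (⟦⟧-∨ (S P w) (v == w)) ⟩
      (⟦ S P w ⟧ + ⟦ v == w ⟧) + (⟦ D w ⟧ + classes) ≡⟨ lemma ⟦ S P w ⟧ ⟦ v == w ⟧ ⟦ D w ⟧ classes ⟩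
      (⟦ D w ⟧ + ⟦ v == w ⟧) + (⟦ S P w ⟧ + classes) ≡⟨ cong (_+ (⟦ S P w ⟧ + classes)) (⟦∖⟧ {p = remainder P} (singleton-⊆ {p = remainder P} Rv) w) ⟩
      ⟦ remainder P w ⟧ + (⟦ S P w ⟧ + classes) ≡⟨ partition P w ⟩
      ⟦ U w ⟧ ∎
      where
      open ≤-Reasoning
      classes = ∑ (λ i → ⟦ C P i w ⟧)
      lemma : ∀ a b c d → (a + b) + (c + d) ≡ (c + b) + (a + d)
      lemma = solve-∀
    closed′ : ∀ {u w} → Adj u w → D u ≡ true → U w ≡ true → D w ≡ true ⊎ S′ w ≡ true
    closed′ {u} {w} adj Du Uw with remainder-closed P adj (proj₁ (∈∖⇒ {p = remainder P} {v ==_} Du)) Uw | bool-cases (v == w)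
    ... | inj₂ Sw | _ = inj₂ (∨-trueˡ Sw)
    ... | inj₁ _ | inj₁ q = inj₂ (∨-trueʳ {S P w} q)
    ... | inj₁ Rw | inj₂ q = inj₁ (⇒∈∖ {p = remainder P} {v ==_} Rw q)
    even-remainder : par (count (remainder P)) ≡ false
    even-remainder = begin
      par (count (remainder P)) ≡⟨ trans (cong (par (count (remainder P)) xor_) (xor-same (par r))) (xor-identityʳ _) ⟨
      par (count (remainder P)) xor (par r xor par r)
        ≡⟨ cong (λ x → par (count (remainder P)) xor (par x xor par r)) (≤-antisym tight (tutte P)) ⟨
      par (count (remainder P)) xor (par (count (S P)) xor par r) ≡⟨ remainder-parity P ⟩
      par (count U) ≡⟨ tutte⇒even tutte ⟩
      false ∎
      where
      open ≡-Reasoning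
    odd′ : par (count D) ≡ true
    odd′ = not-injective (trans (cong par (count-remove (remainder P) Rv)) even-remainder)

  -- The class `C P i` gives way to the classes of `Q`, while `v` and `S Q` join `S P`.
  refine : ∀ {U} (P : Packing U (suc r)) (i : Fin (suc r)) {v : Fin k} → C P i v ≡ true →
           (Q : Packing (C P i ∖ (v ==_)) q) → Σ[ P′ ∈ Packing U (r + q) ] (count (S P′) ≤ count (S P) + suc (count (S Q)))
  refine {r = r} {q = q} {U = U} P i {v} Civ Q = P′ , count-S′
    where
    S′ : VSet k
    S′ = S P ∪ (v ==_) ∪ S Q
    C′ : Fin (r + q) → VSet k
    C′ = (C P ∘ punchIn i) ++ C Q
    Uᵢ = C P i ∖ (v ==_)
    count-S′ : count S′ ≤ count (S P) + suc (count (S Q))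
    count-S′ = ≤-trans (count-∨ (S P) _) (+-monoʳ-≤ (count (S P)) (≤-trans (count-∨ (v ==_) (S Q))
      (≤-reflexive (cong (_+ count (S Q)) (count-singleton v)))))
    ∑-C′ : ∀ w → ∑ (λ i → ⟦ C′ i w ⟧) ≡ ∑ (λ i′ → ⟦ C P (punchIn i i′) w ⟧) + ∑ (λ i → ⟦ C Q i w ⟧)
    ∑-C′ w = trans (∑-split r _) (cong₂ _+_
      (∑-cong λ i′ → cong (λ c → ⟦ c w ⟧) (lookup-++ˡ (C P ∘ punchIn i) (C Q) i′))
      (∑-cong λ i′ → cong (λ c → ⟦ c w ⟧) (lookup-++ʳ (C P ∘ punchIn i) (C Q) i′)))
    disjoint′ : ∀ w → ⟦ S′ w ⟧ + ∑ (λ i → ⟦ C′ i w ⟧) ≤ ⟦ U w ⟧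
    disjoint′ w = begin
      ⟦ S′ w ⟧ + ∑ (λ i → ⟦ C′ i w ⟧)
        ≤⟨ +-mono-≤ (≤-trans (⟦⟧-∨ (S P w) _) (+-monoʳ-≤ ⟦ S P w ⟧ (⟦⟧-∨ (v == w) (S Q w)))) (≤-reflexive (∑-C′ w)) ⟩
      (⟦ S P w ⟧ + (⟦ v == w ⟧ + ⟦ S Q w ⟧)) + (others + ∑ (λ i → ⟦ C Q i w ⟧))
        ≡⟨ lemma ⟦ S P w ⟧ ⟦ v == w ⟧ ⟦ S Q w ⟧ others _ ⟩
      ⟦ S P w ⟧ + (((⟦ S Q w ⟧ + ∑ (λ i → ⟦ C Q i w ⟧)) + ⟦ v == w ⟧) + others)
        ≤⟨ +-monoʳ-≤ ⟦ S P w ⟧ (+-monoˡ-≤ others (+-monoˡ-≤ ⟦ v == w ⟧ (disjoint Q w))) ⟩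
      ⟦ S P w ⟧ + ((⟦ Uᵢ w ⟧ + ⟦ v == w ⟧) + others)
        ≡⟨ cong (λ x → ⟦ S P w ⟧ + (x + others)) (⟦∖⟧ {p = C P i} (singleton-⊆ {p = C P i} Civ) w) ⟩
      ⟦ S P w ⟧ + (⟦ C P i w ⟧ + others) ≡⟨ cong (⟦ S P w ⟧ +_) (∑-removeAt (λ i → ⟦ C P i w ⟧) i) ⟨
      ⟦ S P w ⟧ + ∑ (λ i → ⟦ C P i w ⟧) ≤⟨ disjoint P w ⟩
      ⟦ U w ⟧ ∎
      where
      open ≤-Reasoning
      others = ∑ (λ i′ → ⟦ C P (punchIn i i′) w ⟧)
      lemma : ∀ a b c d e → (a + (b + c)) + (d + e) ≡ a + (((c + e) + b) + d)
      lemma = solve-∀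
    closed′ : ∀ i′ {u w} → Adj u w → C′ i′ u ≡ true → U w ≡ true → C′ i′ w ≡ true ⊎ S′ w ≡ true
    closed′ i′ {u} {w} adj Cu Uw with splitAt r i′
    ... | inj₁ j = map₂ ∨-trueˡ (closed P (punchIn i j) adj Cu Uw)
    ... | inj₂ j with closed P i adj (proj₁ (∈∖⇒ {p = C P i} {v ==_} (C⊆U Q j u Cu))) Uw | bool-cases (v == w)
    ... | inj₂ Sw | _ = inj₂ (∨-trueˡ Sw)
    ... | inj₁ _ | inj₁ h = inj₂ (∨-trueʳ {S P w} (∨-trueˡ h))
    ... | inj₁ Cw | inj₂ h = map₂ (λ h → ∨-trueʳ {S P w} (∨-trueʳ {v == w} h))
                               (closed Q j adj Cu (⇒∈∖ {p = C P i} {v ==_} Cw h))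
    odd′ : ∀ i′ → par (count (C′ i′)) ≡ true
    odd′ i′ with splitAt r i′
    ... | inj₁ j = odd P (punchIn i j)
    ... | inj₂ j = odd Q j
    P′ : Packing U (r + q)
    P′ = record { S = S′ ; C = C′ ; disjoint = disjoint′ ; closed = closed′ ; odd = odd′ }

  -- The class without `v` is even, so a violation has excess at least 2. This pays for `v` and for
  -- the lost class: refining gives a tight packing with more classes.
  tutte-class : ∀ {U} (P : Packing U r) → Tight P → Maximal P → (i : Fin r) {v : Fin k} → C P i v ≡ true →
                TutteCondition (C P i ∖ (v ==_))
  tutte-class {suc r} {U} P tight maximal i {v} Civ {q} Q with q ≤? count (S Q)
  ... | yes h = h
  ... | no h = let
      (q′ , Q′ , gap) = excess even Q (≰⇒> h)
      (P′ , S′≤) = refine P i Civ Q′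
      in contradiction (+-cancelˡ-≤ r _ _ (≤-trans
           (maximal P′ (≤-trans S′≤ (≤-trans (+-monoˡ-≤ _ tight) (≤-trans (≤-reflexive (lemma r _)) (+-monoʳ-≤ r gap)))))
           (≤-reflexive (+-comm 1 r))))
         (<⇒≱ (≤-trans (s≤s (s≤s z≤n)) gap))
    where
    lemma : ∀ a b → suc a + suc b ≡ a + (2 + b)
    lemma = solve-∀
    even : par (count (C P i ∖ (v ==_))) ≡ false
    even = not-injective (trans (cong par (count-remove (C P i) Civ)) (odd P i))

  Meets : ∀ {U} → Packing U r → Fin r → Fin k → Set
  Meets P i s = Σ[ v ∈ Fin k ] (C P i v ≡ true × Adj v s)

  -- The classes in `J`, with a set `T` that contains their neighbours in `S P`, are again a
  -- packing, to which Tutte's condition applies.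
  tutte⇒hall : ∀ {U} → TutteCondition U → (P : Packing U r) (default : Fin k) →
               Hall.HallCondition (Meets P) default (λ _ → true) (S P)
  tutte⇒hall {U = U} tutte P default J T _ T⊆S neighbours = tutte record
    { S = T
    ; C = C P ∘ emb E
    ; disjoint = λ v → ≤-trans (+-mono-≤ (lemma (T v) (S P v) (T⊆S v))
        (≤-trans (≤-reflexive (∑-emb E (λ i → ⟦ C P i v ⟧))) (∑-mono λ i → ·-≤ (J i) _))) (disjoint P v)
    ; closed = λ i adj Cu Uw → map₂ (λ Sw → neighbours _ _ (emb-mem E i) Sw (_ , Cu , adj)) (closed P (emb E i) adj Cu Uw)
    ; odd = λ i → odd P (emb E i) }
    where
    E : Enum J (count J)
    E = enum J
    lemma : ∀ b c → (b ≡ true → c ≡ true) → ⟦ b ⟧ ≤ ⟦ c ⟧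
    lemma true c h rewrite h refl = ≤-refl
    lemma false c h = z≤n
    ·-≤ : ∀ b x → b · x ≤ x
    ·-≤ true x = ≤-refl
    ·-≤ false x = z≤n

  odd⇒member : (p : VSet k) → par (count p) ≡ true → ∃[ v ] p v ≡ true
  odd⇒member p h with 1 ≤? count p
  ... | yes q = count>0⇒member p q
  ... | no q = contradiction (trans (sym h) (cong par (n≤0⇒n≡0 (≤-pred (≰⇒> q))))) λ ()

  representatives : ∀ {U} → TutteCondition U → (P : Packing U r) →
    ¬ ¬ (Σ[ g ∈ (Fin r → Fin k) ] ((∀ i → S P (g i) ≡ true × Meets P i (g i)) × (∀ i i′ → g i ≡ g i′ → i ≡ i′)))
  representatives {zero} tutte P h = h ((λ ()) , (λ ()) , λ ())
  representatives {suc r} tutte P h = hall (λ _ → true) (S P) (tutte⇒hall tutte P default)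
    λ (g , good , inj-g) → h (g , (λ i → good i refl) , (λ i i′ → inj-g i i′ refl refl))
    where
    default : Fin k
    -- An odd class is nonempty and so supplies a vertex.
    default = proj₁ (odd⇒member (C P zero) (odd P zero))
    open Hall (Meets P) default

  -- By tightness the injective `g` exhausts `S P`, so the classes and their representatives
  -- partition `U`.
  assemble : ∀ {U} (P : Packing U r) → Tight P → (∀ v → remainder P v ≡ false) →
    (g : Fin r → Fin k) → (∀ i → S P (g i) ≡ true) → (∀ i i′ → g i ≡ g i′ → i ≡ i′) →
    (∀ i → Match (λ v → ⟦ C P i v ⟧ + ⟦ g i == v ⟧)) → Match (λ v → ⟦ U v ⟧)
  assemble {r = r} {U = U} P tight no-remainder g g∈S inj-g matches =
    Match-cong total (Match-∑ matches λ v → ≤-trans (≤-reflexive (total v)) (⟦⟧≤1 (U v)))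
    where
    open ≡-Reasoning
    hits : Fin k → ℕ
    hits v = ∑ (λ i → ⟦ g i == v ⟧)
    hits≤ : ∀ v → hits v ≤ ⟦ S P v ⟧
    hits≤ v with S P v in eq
    ... | true = count≤1 (λ i → g i == v) λ i i′ q q′ → inj-g i i′ (trans (==⇒≡ q) (sym (==⇒≡ q′)))
    ... | false = ≤-reflexive (∑-zero λ i → cong ⟦_⟧ (==-separates (S P) (g∈S i) eq))
    ∑-hits : ∑ hits ≡ r
    ∑-hits = trans (∑-swap (λ v i → ⟦ g i == v ⟧)) (trans (∑-cong λ i → count-singleton (g i)) (trans (∑-const {r} 1) (*-identityʳ r)))
    hits≡ : ∀ v → hits v ≡ ⟦ S P v ⟧
    hits≡ = ∑-tight hits≤ (≤-trans tight (≤-reflexive (sym ∑-hits)))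
    total : ∀ v → ∑ (λ i → ⟦ C P i v ⟧ + ⟦ g i == v ⟧) ≡ ⟦ U v ⟧
    total v = begin
      ∑ (λ i → ⟦ C P i v ⟧ + ⟦ g i == v ⟧) ≡⟨ ∑-+ _ _ ⟩
      ∑ (λ i → ⟦ C P i v ⟧) + hits v ≡⟨ cong (∑ (λ i → ⟦ C P i v ⟧) +_) (hits≡ v) ⟩
      ∑ (λ i → ⟦ C P i v ⟧) + ⟦ S P v ⟧ ≡⟨ +-comm _ ⟦ S P v ⟧ ⟩
      ⟦ S P v ⟧ + ∑ (λ i → ⟦ C P i v ⟧) ≡⟨ cong (λ b → ⟦ b ⟧ + (⟦ S P v ⟧ + ∑ (λ i → ⟦ C P i v ⟧))) (no-remainder v) ⟨
      ⟦ remainder P v ⟧ + (⟦ S P v ⟧ + ∑ (λ i → ⟦ C P i v ⟧)) ≡⟨ partition P v ⟩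
      ⟦ U v ⟧ ∎

  match-class : ∀ {U} (P : Packing U r) (i : Fin r) {v s : Fin k} → C P i v ≡ true → S P s ≡ true → Adj v s →
                Match (λ w → ⟦ (C P i ∖ (v ==_)) w ⟧) → Match (λ w → ⟦ C P i w ⟧ + ⟦ s == w ⟧)
  match-class P i {v} {s} Civ Ss adj match = Match-cong total
      (Match-+ match (Match-edge adj) λ w → ≤-trans (≤-reflexive (total w)) (bound w))
    where
    total : ∀ w → ⟦ (C P i ∖ (v ==_)) w ⟧ + (⟦ v == w ⟧ + ⟦ s == w ⟧) ≡ ⟦ C P i w ⟧ + ⟦ s == w ⟧
    total w = trans (sym (+-assoc ⟦ (C P i ∖ (v ==_)) w ⟧ _ _))
      (cong (_+ ⟦ s == w ⟧) (⟦∖⟧ {p = C P i} (singleton-⊆ {p = C P i} Civ) w))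
    bound : ∀ w → ⟦ C P i w ⟧ + ⟦ s == w ⟧ ≤ 1
    bound w with C P i w in eq
    ... | false = ⟦⟧≤1 (s == w)
    ... | true rewrite ≢⇒==false {a = s} {w} (λ { refl → S∌C P {i} Ss eq }) = ≤-refl

  -- Each class meets its own vertex of `S` along an edge from some `v` in the class. The class
  -- without `v` is smaller than `U` and inherits Tutte's condition.
  tutte′ : ∀ fuel U → count U < fuel → TutteCondition U → ¬ ¬ Match (λ v → ⟦ U v ⟧)
  tutte′ (suc fuel) U (s≤s U≤) tutte ¬match =
    maximal-tight tutte λ (r , P , tight , maximal) →
    representatives tutte P λ (g , good , inj-g) →
    ¬¬-Fin (λ i → let (_ , v , Civ , _) = good i in
      tutte′ fuel (C P i ∖ (v ==_))
        (≤-trans (≤-reflexive (count-remove (C P i) Civ)) (≤-trans (count-⊆ (C⊆U P i)) U≤))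
        (tutte-class P tight maximal i Civ)) λ matches →
    ¬match (assemble P tight (maximal⇒no-remainder tutte P tight maximal) g (proj₁ ∘ good) inj-g
      λ i → let (Sg , v , Civ , adj) = good i in match-class P i Civ Sg adj (matches i))

  tutte : ∀ U → TutteCondition U → ¬ ¬ Match (λ v → ⟦ U v ⟧)
  tutte U = tutte′ _ U ≤-refl

-- Degree counting and Tutte's condition in 5-regular graphs.

par-double : ∀ x → par (2 * x) ≡ false
par-double x rewrite +-identityʳ x | par-+ x x = xor-same (par x)

par-+-double : ∀ x y → par (x + 2 * y) ≡ par x
par-+-double x y = trans (par-+ x _) (trans (cong (par x xor_) (par-double y)) (xor-identityʳ (par x)))

par-5* : ∀ x → par (5 * x) ≡ par x
par-5* x = trans (cong par (lemma x)) (par-+-double x (2 * x))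
  where
  lemma : ∀ x → 5 * x ≡ x + 2 * (2 * x)
  lemma = solve-∀

·-∑ : ∀ b (f : Fin k → ℕ) → b · ∑ f ≡ ∑ (λ i → b · f i)
·-∑ true f = refl
·-∑ false f = sym (∑-zero λ _ → refl)

count-cong : {p q : VSet k} → (∀ i → p i ≡ q i) → count p ≡ count q
count-cong p≗q = ∑-cong λ i → cong ⟦_⟧ (p≗q i)

count≤1⇒singleton : (X : VSet k) {v : Fin k} → X v ≡ true → count X ≤ 1 → ∀ w → X w ≡ (v == w)
count≤1⇒singleton X {v} Xv X≤1 w = ⟦⟧-injective (trans (sym (⟦∖⟧ {p = X} (singleton-⊆ {p = X} Xv) w))
  (cong (λ b → ⟦ b ⟧ + ⟦ v == w ⟧) (count≡0⇒empty (X ∖ (v ==_)) X∖v w)))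
  where
  X∖v : count (X ∖ (v ==_)) ≡ 0
  X∖v = n≤0⇒n≡0 (≤-pred (≤-trans (≤-reflexive (count-remove X Xv)) X≤1))

module Handshake (en : Fin l → Fin k × Fin k) where
  open Cuts en
  open Matching en

  handshake : (X : VSet k) → ∑ (λ v → X v · deg (λ _ → true) v) ≡ ∑ (λ e → ⟦ X (proj₁ (en e)) ⟧ + ⟦ X (proj₂ (en e)) ⟧)
  handshake X = begin
    ∑ (λ v → X v · deg (λ _ → true) v) ≡⟨ ∑-cong (λ v → ·-∑ (X v) _) ⟩
    ∑ (λ v → ∑ (λ e → X v · incidence v (en e))) ≡⟨ ∑-swap _ ⟩
    ∑ (λ e → ∑ (λ v → X v · incidence v (en e)))
      ≡⟨ ∑-cong (λ e → trans (∑-cong λ v → ·-+ (X v) _ _) (trans (∑-+ _ _)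
           (cong₂ _+_ (∑-indicator X (proj₁ (en e))) (∑-indicator X (proj₂ (en e)))))) ⟩
    ∑ (λ e → ⟦ X (proj₁ (en e)) ⟧ + ⟦ X (proj₂ (en e)) ⟧) ∎
    where open ≡-Reasoning

  module _ (regular : ∀ v → deg (λ _ → true) v ≡ 5) where

    regular-handshake : (X : VSet k) → 5 * count X ≡ ∑ (λ e → ⟦ X (proj₁ (en e)) ⟧ + ⟦ X (proj₂ (en e)) ⟧)
    regular-handshake X = trans (sym (∑-* 5 _)) (trans (∑-cong pointwise) (handshake X))
      where
      pointwise : ∀ v → 5 * ⟦ X v ⟧ ≡ X v · deg (λ _ → true) v
      pointwise v rewrite regular v with X v
      ... | true = refl
      ... | false = refl

    -- Among the edge ends in `X`, a cut edge has one and an inner edge two.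
    cut-handshake : (X : VSet k) → 5 * count X ≡ count (cut X) + 2 * count (ins X)
    cut-handshake X = trans (regular-handshake X) (trans (∑-cong λ e → pointwise (X (proj₁ (en e))) (X (proj₂ (en e))))
      (trans (∑-+ _ _) (cong (count (cut X) +_) (∑-* 2 _))))
      where
      pointwise : ∀ x y → ⟦ x ⟧ + ⟦ y ⟧ ≡ ⟦ x xor y ⟧ + 2 * ⟦ x ∧ y ⟧
      pointwise true true = refl
      pointwise true false = refl
      pointwise false true = refl
      pointwise false false = refl

    cut-parity : (X : VSet k) → par (count X) ≡ par (count (cut X))
    cut-parity X = trans (sym (par-5* (count X))) (trans (cong par (cut-handshake X)) (par-+-double (count (cut X)) (count (ins X))))

    edge-bound : 5 * k ≤ 2 * l
    edge-bound = begin
      5 * k ≡⟨ cong (5 *_) count-full ⟨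
      5 * count {k} (λ _ → true) ≡⟨ cut-handshake (λ _ → true) ⟩
      count {l} (λ _ → false) + 2 * count {l} (λ _ → true)
        ≡⟨ cong₂ (λ x y → x + 2 * y) (∑-zero {f = λ _ → 0} λ _ → refl) count-full ⟩
      2 * l ∎
      where open ≤-Reasoning

    -- The cut of an odd class is odd, so it has at least 5 edges. An edge lies in no more of these
    -- cuts than it has ends in `S`, and `S` has 5 edge ends per vertex.
    tutteCondition : (∀ X {u v} → X u ≡ true → X v ≡ false → 4 ≤ count (cut X)) → TutteCondition (λ _ → true)
    tutteCondition 4≤cut {r} P = *-cancelˡ-≤ 5 (begin
        5 * r ≡⟨ *-comm 5 r ⟩
        r * 5 ≡⟨ ∑-const 5 ⟨
        ∑ {r} (λ _ → 5) ≤⟨ ∑-mono 5≤cut ⟩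
        ∑ (λ i → count (cut (C i))) ≡⟨ ∑-swap _ ⟩
        ∑ (λ e → ∑ (λ i → ⟦ cut (C i) e ⟧)) ≤⟨ ∑-mono pointwise ⟩
        ∑ (λ e → ⟦ S (proj₁ (en e)) ⟧ + ⟦ S (proj₂ (en e)) ⟧) ≡⟨ regular-handshake S ⟨
        5 * count S ∎)
      where
      open Packing P
      open ≤-Reasoning
      odd-cut : ∀ i → par (count (cut (C i))) ≡ true
      odd-cut i = trans (sym (cut-parity (C i))) (odd i)
      5≤cut : ∀ i → 5 ≤ count (cut (C i))
      5≤cut i with any? (λ v → C i v Bool.≟ false)
      -- A class containing every vertex would have an empty cut, which is even.
      ... | no all = contradiction (trans (sym (odd-cut i)) (cong par (∑-zero λ e →
          cong ⟦_⟧ (cong₂ _xor_ (member (proj₁ (en e))) (member (proj₂ (en e))))))) λ ()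
        where
        member : ∀ v → C i v ≡ true
        member v with bool-cases (C i v)
        ... | inj₁ q = q
        ... | inj₂ q = contradiction (v , q) all
      ... | yes (v , ¬Cv) with m≤n⇒m<n∨m≡n (4≤cut (C i) (proj₂ (odd⇒member (C i) (odd i))) ¬Cv)
      ... | inj₁ q = q
      ... | inj₂ q = contradiction (trans (cong par q) (odd-cut i)) λ ()
      false-in-C : ∀ {v} → S v ≡ true → ∀ i → C i v ≡ false
      false-in-C {v} Sv i with bool-cases (C i v)
      ... | inj₁ q = ⊥-elim (S∌C Sv q)
      ... | inj₂ q = q
      transfer : ∀ {u w} → Adj u w → S w ≡ false → ∀ i → C i u ≡ true → C i w ≡ true
      transfer adj ¬Sw i Cu with closed i adj Cu refl
      ... | inj₁ q = q
      ... | inj₂ q = ⊥-elim (true≢false q ¬Sw)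
      classes≤1 : ∀ v → ∑ (λ i → ⟦ C i v ⟧) ≤ 1
      classes≤1 v = ≤-trans (m≤n+m _ _) (disjoint v)
      xor-equal : ∀ {x y} → (x ≡ true → y ≡ true) → (y ≡ true → x ≡ true) → ⟦ x xor y ⟧ ≡ 0
      xor-equal {true} f g rewrite f refl = refl
      xor-equal {false} {true} f g = contradiction (g refl) λ ()
      xor-equal {false} {false} f g = refl
      xor-false : ∀ {x y} → y ≡ false → ⟦ x xor y ⟧ ≡ ⟦ x ⟧
      xor-false {true} refl = refl
      xor-false {false} refl = refl
      -- If one end is in `S`, the other is in at most one class. If neither is, closedness puts
      -- both ends into the same classes.
      pointwise : ∀ e → ∑ (λ i → ⟦ cut (C i) e ⟧) ≤ ⟦ S (proj₁ (en e)) ⟧ + ⟦ S (proj₂ (en e)) ⟧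
      pointwise e with bool-cases (S (proj₁ (en e))) | bool-cases (S (proj₂ (en e)))
      ... | inj₁ p | _ = ≤-trans (≤-trans (≤-reflexive (∑-cong λ i → cong (λ b → ⟦ b xor C i (proj₂ (en e)) ⟧) (false-in-C p i)))
             (≤-trans (classes≤1 (proj₂ (en e))) (≤-reflexive (sym (cong ⟦_⟧ p))))) (m≤m+n _ _)
      ... | inj₂ _ | inj₁ q = ≤-trans (≤-trans (≤-reflexive (∑-cong λ i → xor-false (false-in-C q i)))
             (≤-trans (classes≤1 (proj₁ (en e))) (≤-reflexive (sym (cong ⟦_⟧ q))))) (m≤n+m _ _)
      ... | inj₂ p | inj₂ q = ≤-trans (≤-reflexive (∑-zero λ i →
             xor-equal (transfer (e , inj₁ refl) q i) (transfer (e , inj₂ refl) p i))) z≤n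

-- Connectivity and crossed vertex sets.

module Connectivity (G : Graph) where
  open Cuts (ends G)

  AdjIn-cut : (F : Subset (m G)) (X : VSet (n G)) {e : Edge G} → lookup F e ≡ true → cut X e ≡ true →
              AdjIn G F (inner X e) (inner (not ∘ X) e)
  AdjIn-cut F X {e} e∈F q with X (proj₁ (ends G e)) | X (proj₂ (ends G e))
  ... | true | false = e , lookup⇒[]= e F e∈F , inj₁ refl
  ... | false | true = e , lookup⇒[]= e F e∈F , inj₂ refl

  -- The set of vertices known to be reachable from `u` grows along crossing edges until it contains
  -- `v`; the fuel bounds the number of vertices still missing.
  crossed⇒connected : (F : Subset (m G)) →
    (∀ X {u v} → X u ≡ true → X v ≡ false → ∃[ e ] (lookup F e ≡ true × cut X e ≡ true)) → ConnectedIn G F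
  crossed⇒connected F crossed u v =
    grow (n G) (u ==_) (==-refl u) (λ w q → subst (Star (AdjIn G F) u) (==⇒≡ q) ε) (m≤n+m _ _)
    where
    grow : ∀ fuel X → X u ≡ true → (∀ w → X w ≡ true → Star (AdjIn G F) u w) → n G ≤ count X + fuel → Star (AdjIn G F) u v
    grow fuel X Xu reach bound with bool-cases (X v)
    ... | inj₁ Xv = reach v Xv
    grow zero X Xu reach bound | inj₂ ¬Xv =
      contradiction (count<size X ¬Xv) (≤⇒≯ (≤-trans bound (≤-reflexive (+-identityʳ _))))
    grow (suc fuel) X Xu reach bound | inj₂ ¬Xv with crossed X Xu ¬Xv
    ... | e , e∈F , q = grow fuel (X ∪ (w ==_)) (∨-trueˡ Xu) reach′
        (≤-trans bound (≤-reflexive (trans (+-suc (count X) fuel) (cong (_+ fuel) grown))))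
      where
      w : Vertex G
      w = inner (not ∘ X) e
      grown : suc (count X) ≡ count (X ∪ (w ==_))
      grown = trans (+-comm 1 _) (trans (cong (count X +_) (sym (count-singleton w)))
        (count-disjoint-∪ X (w ==_) λ i Xi → trans (==-sym w i) (==-separates X Xi (outer∉ X q))))
      reach′ : ∀ v → (X ∪ (w ==_)) v ≡ true → Star (AdjIn G F) u v
      reach′ v h with ∨-true {X v} h
      ... | inj₁ Xv = reach v Xv
      ... | inj₂ h′ = subst (Star (AdjIn G F) u) (==⇒≡ h′) (reach _ (inner∈ X q) ◅◅ (AdjIn-cut F X e∈F q ◅ ε))

  connected⇒crossed : (F : Subset (m G)) → ConnectedIn G F → ∀ X {u v} → X u ≡ true → X v ≡ false →
                      ∃[ e ] (lookup F e ≡ true × cut X e ≡ true)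
  connected⇒crossed F connected X Xu ¬Xv = walk (connected _ _) Xu ¬Xv
    where
    walk : ∀ {u v} → Star (AdjIn G F) u v → X u ≡ true → X v ≡ false → ∃[ e ] (lookup F e ≡ true × cut X e ≡ true)
    walk ε Xu ¬Xu = ⊥-elim (true≢false Xu ¬Xu)
    walk {u} (_◅_ {j = w} (e , e∈F , adj) path) Xu ¬Xv with bool-cases (X w)
    ... | inj₁ Xw = walk path Xw ¬Xv
    ... | inj₂ ¬Xw = e , []=⇒lookup e∈F , crosses adj
      where
      crosses : ends G e ≡ (u , w) ⊎ ends G e ≡ (w , u) → cut X e ≡ true
      crosses (inj₁ q) rewrite q | Xu | ¬Xw = refl
      crosses (inj₂ q) rewrite q | Xu | ¬Xw = refl

  cut-tabulate : (X : VSet (n G)) (e : Edge G) → cut (lookup (tabulate X)) e ≡ cut X e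
  cut-tabulate X e = cong₂ _xor_ (lookup∘tabulate X _) (lookup∘tabulate X _)

  -- Stated for `Subset`, where a decidable property can be searched for.
  Proper : Subset (n G) → Set
  Proper X = (∃[ u ] lookup X u ≡ true) × (∃[ v ] lookup X v ≡ false)

  proper? : ∀ X → Dec (Proper X)
  proper? X = any? (λ u → lookup X u Bool.≟ true) ×-dec any? (λ v → lookup X v Bool.≟ false)

  tabulate-proper : ∀ (X : VSet (n G)) {u v} → X u ≡ true → X v ≡ false → Proper (tabulate X)
  tabulate-proper X Xu ¬Xv = (_ , trans (lookup∘tabulate X _) Xu) , (_ , trans (lookup∘tabulate X _) ¬Xv)

  -- A finite search over all vertex sets yields the witness constructively; its failure would mean
  -- that every proper set is crossed.
  disconnected⇒uncrossed : (F : Subset (m G)) → ¬ ConnectedIn G F →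
    ∃[ X ] (Proper X × (∀ e → cut (lookup X) e ≡ true → lookup F e ≡ false))
  disconnected⇒uncrossed F disconnected
    with anySubset? (λ X → proper? X ×-dec all? (λ e → (cut (lookup X) e Bool.≟ true) →-dec (lookup F e Bool.≟ false)))
  ... | yes found = found
  ... | no none = contradiction (crossed⇒connected F crossed) disconnected
    where
    crossed : ∀ X {u v} → X u ≡ true → X v ≡ false → ∃[ e ] (lookup F e ≡ true × cut X e ≡ true)
    crossed X Xu ¬Xv with any? (λ e → (lookup F e Bool.≟ true) ×-dec (cut X e Bool.≟ true))
    ... | yes found = found
    ... | no uncrossed = contradiction (tabulate X , tabulate-proper X Xu ¬Xv , avoid) none
      where
      avoid : ∀ e → cut (lookup (tabulate X)) e ≡ true → lookup F e ≡ false
      avoid e q with bool-cases (lookup F e)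
      ... | inj₁ h = contradiction (e , h , trans (sym (cut-tabulate X e)) q) uncrossed
      ... | inj₂ h = h

-- The properties of a minimal counterexample.

module MinimalCounterexample (G : Graph) (regularG : Regular 5 G) (no-41 : ¬ Has41Factor G)
  (smaller : ∀ H → n H < n G → Regular 5 H → Has41Factor H) where

  open Cuts (ends G)
  open Connectivity G
  open Handshake (ends G)
  open Matching (ends G) using (Match; tutte)

  regular : ∀ v → deg (λ _ → true) v ≡ 5
  regular v = trans (sym (degree≡degF G v)) (regularG v)

  no-factor : ¬ (∃[ F ] (∀ v → Is41 (deg F v)))
  no-factor (F , is41) = no-41 (tabulate F , λ v → subst Is41 (sym (trans (degreeIn≡degF G (tabulate F) v)
    (∑-cong λ e → cong (_· incidence v (ends G e)) (lookup∘tabulate F e)))) (is41 v))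

  open Minimal (ends G)

  uncut : (X : VSet (n G)) → (∀ e → cut X e ≡ false) → ∀ {u v} → X u ≡ true → X v ≡ false → ⊥
  uncut X empty = no-cut₀ regular smaller no-factor X (∑-zero λ e → cong ⟦_⟧ (empty e))

  -- Excluding cuts with two or more vertices on either side leaves those with at most one vertex on
  -- some side.
  small-side : (X : VSet (n G)) → (suc (count X) < n G → suc (count (not ∘ X)) < n G → ⊥) →
               count X ≤ 1 ⊎ count (not ∘ X) ≤ 1
  small-side X both with suc (count X) <? n G | suc (count (not ∘ X)) <? n G
  ... | yes p | yes q = ⊥-elim (both p q)
  ... | no p | _ = inj₂ (+-cancelˡ-≤ (count X) _ _ (≤-trans (≤-reflexive (count-not X)) (≤-trans (≮⇒≥ p) (≤-reflexive (+-comm 1 _)))))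
  ... | yes _ | no q = inj₁ (+-cancelʳ-≤ (count (not ∘ X)) _ _ (≤-trans (≤-reflexive (count-not X)) (≮⇒≥ q)))

  connected : Connected G
  connected = crossed⇒connected Subset.⊤ crossed
    where
    crossed : ∀ X {u v} → X u ≡ true → X v ≡ false → ∃[ e ] (lookup Subset.⊤ e ≡ true × cut X e ≡ true)
    crossed X Xu ¬Xv with any? (λ e → cut X e Bool.≟ true)
    ... | yes (e , q) = e , lookup-replicate e true , q
    ... | no none = ⊥-elim (uncut X (λ e → not-true e (bool-cases (cut X e))) Xu ¬Xv)
      where
      not-true : ∀ e → cut X e ≡ true ⊎ cut X e ≡ false → cut X e ≡ false
      not-true e (inj₁ q) = contradiction (e , q) none
      not-true e (inj₂ q) = q

  small-cut : ∃[ X ] (Proper X × count (cut (lookup X)) ≤ 3)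
  small-cut with anySubset? (λ X → proper? X ×-dec (count (cut (lookup X)) ≤? 3))
  ... | yes found = found
  -- The goal is absurdity, so a perfect matching up to double negation is enough.
  ... | no none = ⊥-elim (tutte (λ _ → true) (tutteCondition regular 4≤cut)
      λ (F , perfect) → no-factor (F , λ v → inj₂ (perfect v)))
    where
    4≤cut : ∀ X {u v} → X u ≡ true → X v ≡ false → 4 ≤ count (cut X)
    4≤cut X Xu ¬Xv = subst (4 ≤_) (count-cong (cut-tabulate X))
      (≰⇒> λ q → none (tabulate X , tabulate-proper X Xu ¬Xv , q))

  -- An edge cut need not be minimal, so the few edges that leave some proper set may be padded to
  -- three.
  three-edge-cut : ∃[ S ] (∣ S ∣ ≡ 3 × EdgeCut G S)
  three-edge-cut with small-cut
  ... | X , ((u , Xu) , (v , ¬Xv)) , cut≤3 with count-extend (cut (lookup X)) 3 cut≤3 3≤m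
    where
    3≤m : 3 ≤ m G
    -- Two edges have four ends, while a single vertex already has degree 5.
    3≤m = ≮⇒≥ λ m<3 → <⇒≱ (≤-trans (s≤s (*-monoʳ-≤ 2 (≤-pred m<3))) (*-monoʳ-≤ 5 (≤-trans (s≤s z≤n) (count<size (lookup X) ¬Xv))))
                          (edge-bound regular)
  ... | q , q≡3 , cut⊆q = tabulate q , trans (∣tabulate∣ q) q≡3 , connected , disconnected
    where
    disconnected : ¬ ConnectedIn G (∁ (tabulate q))
    disconnected c with connected⇒crossed _ c (lookup X) Xu ¬Xv
    ... | e , e∈ , crosses = true≢false (trans (sym (trans (lookup-map e not (tabulate q)) (cong not (lookup∘tabulate q e)))) e∈)
      (cong not (cut⊆q e crosses))

  edge-cut-side : ∀ S → EdgeCut G S → ∃[ X ] (Proper X × (∀ e → cut (lookup X) e ≡ true → e ∈ S))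
  edge-cut-side S (_ , disconnected) with disconnected⇒uncrossed (∁ S) disconnected
  ... | X , proper , avoid = X , proper , λ e q → lookup⇒[]= e S (not-injective (trans (sym (lookup-map e not S)) (avoid e q)))

  -- Restoring `e` reconnects the graph, so some edge outside `S - e` crosses the side; crossing
  -- edges lie in `S`, so it is `e`.
  minimal-cut-side : ∀ S → MinimalEdgeCut G S → ∃[ X ] (∀ e → cut X e ≡ lookup S e)
  minimal-cut-side S (edge-cut , minimal) with edge-cut-side S edge-cut
  ... | X , ((u , Xu) , (v , ¬Xv)) , cut⊆S = lookup X , λ e → same e (bool-cases (lookup S e)) (bool-cases (cut (lookup X) e))
    where
    S⊆cut : ∀ e → e ∈ S → cut (lookup X) e ≡ true
    S⊆cut e e∈S with connected⇒crossed _ (minimal e e∈S) (lookup X) Xu ¬Xv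
    ... | e′ , e′∈ , crosses with e′ ≟ e
    ... | yes refl = crosses
    ... | no e′≢e = ⊥-elim (true≢false (trans (sym (lookup-map e′ not (S Subset.- e))) e′∈)
                      (cong not ([]=⇒lookup (x∈p∧x≢y⇒x∈p-y (cut⊆S e′ crosses) e′≢e))))
    same : ∀ e → lookup S e ≡ true ⊎ lookup S e ≡ false → cut (lookup X) e ≡ true ⊎ cut (lookup X) e ≡ false →
           cut (lookup X) e ≡ lookup S e
    same e (inj₁ p) _ = trans (S⊆cut e (lookup⇒[]= e S p)) (sym p)
    same e (inj₂ p) (inj₁ q) = trans q (sym ([]=⇒lookup (cut⊆S e q)))
    same e (inj₂ p) (inj₂ q) = trans q (sym p)

  -- No edge but `e` crosses the side, and connectedness of `G` supplies one that does.
  bridge-side : ∀ e → IsBridge G e → ∃[ X ] (∀ e′ → cut X e′ ≡ (e == e′))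
  bridge-side e bridge with edge-cut-side _ bridge
  ... | X , ((u , Xu) , (v , ¬Xv)) , cut⊆e = lookup X , λ e′ → same e′ (bool-cases (cut (lookup X) e′))
    where
    only : ∀ {e′} → cut (lookup X) e′ ≡ true → e′ ≡ e
    only {e′} q = x∈⁅y⁆⇒x≡y e (cut⊆e e′ q)
    cut-e : cut (lookup X) e ≡ true
    cut-e with connected⇒crossed _ connected (lookup X) Xu ¬Xv
    ... | e′ , _ , q = subst (λ e → cut (lookup X) e ≡ true) (only q) q
    same : ∀ e′ → cut (lookup X) e′ ≡ true ⊎ cut (lookup X) e′ ≡ false → cut (lookup X) e′ ≡ (e == e′)
    same e′ (inj₁ q) = trans q (sym (trans (cong (e ==_) (only q)) (==-refl e)))
    same e′ (inj₂ q) = trans q (sym (≢⇒==false λ { refl → true≢false cut-e q }))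

  no-2-cut : ∀ S → ∣ S ∣ ≡ 2 → ¬ MinimalEdgeCut G S
  no-2-cut S S≡2 minimal with minimal-cut-side S minimal
  ... | X , cut≗S = no-cut₂ regular smaller no-factor X (trans (count-cong cut≗S) (trans (sym (∣∣≡count S)) S≡2))

  cut-xor : (X Y : VSet (n G)) (e : Edge G) → cut (λ v → X v xor Y v) e ≡ cut X e xor cut Y e
  cut-xor X Y e = interchange (CommutativeRing.+-commutativeSemigroup xor-∧-commutativeRing) (X (proj₁ (ends G e))) (Y (proj₁ (ends G e))) _ _

  no-two-bridges : ¬ (∃[ e₁ ] ∃[ e₂ ] (e₁ ≢ e₂ × IsBridge G e₁ × IsBridge G e₂))
  no-two-bridges (e₁ , e₂ , e₁≢e₂ , bridge₁ , bridge₂) with bridge-side e₁ bridge₁ | bridge-side e₂ bridge₂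
  ... | X₁ , cut₁ | X₂ , cut₂ = no-cut₂ regular smaller no-factor (λ v → X₁ v xor X₂ v)
      (trans (∑-cong λ e → trans (cong ⟦_⟧ (trans (cut-xor X₁ X₂ e) (cong₂ _xor_ (cut₁ e) (cut₂ e)))) (pointwise e))
      (trans (∑-+ _ _) (cong₂ _+_ (count-singleton e₁) (count-singleton e₂))))
    where
    pointwise : ∀ e → ⟦ (e₁ == e) xor (e₂ == e) ⟧ ≡ ⟦ e₁ == e ⟧ + ⟦ e₂ == e ⟧
    pointwise e with bool-cases (e₁ == e)
    ... | inj₂ q rewrite q = refl
    ... | inj₁ q rewrite q | ≢⇒==false {a = e₂} {e} (λ e₂≡e → e₁≢e₂ (trans (==⇒≡ q) (sym e₂≡e))) = refl

  -- Loops at the ends of a bridge.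

  degree-loops : ∀ v → 5 ≡ count (cut (v ==_)) + 2 * loopCount G v
  degree-loops v = begin
    5 * 1 ≡⟨ cong (5 *_) (count-singleton v) ⟨
    5 * count (v ==_) ≡⟨ cut-handshake regular (v ==_) ⟩
    count (cut (v ==_)) + 2 * count (ins (v ==_))
      ≡⟨ cong (λ x → count (cut (v ==_)) + 2 * x)
           (trans (listSum≡∑ _) (∑-cong λ e → cong₂ (λ x y → ⟦ x ∧ y ⟧) (==-sym (proj₁ (ends G e)) v) (==-sym (proj₂ (ends G e)) v))) ⟨
    count (cut (v ==_)) + 2 * loopCount G v ∎
    where open ≡-Reasoning

  cut-cong : ∀ {X Y} → (∀ v → X v ≡ Y v) → ∀ e → cut X e ≡ cut Y e
  cut-cong X≗Y e = cong₂ _xor_ (X≗Y _) (X≗Y _)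

  -- Here `v` is the end of the bridge `e` in its side `X`; it has two loops exactly when it is the
  -- whole side.
  module Leaf (X : VSet (n G)) {e : Edge G} (cut-X : ∀ e′ → cut X e′ ≡ (e == e′)) {v : Vertex G} (Xv : X v ≡ true)
              (cut-v : cut (v ==_) e ≡ true) where

    -- Only `e` leaves the single vertex, and 5 = 1 + 2 * 2.
    single⇒two-loops : count X ≤ 1 → loopCount G v ≡ 2
    single⇒two-loops X≤1 = *-cancelˡ-≡ _ _ 2 (+-cancelˡ-≡ 1 _ _ (sym (trans (degree-loops v)
      (cong (_+ 2 * loopCount G v) (trans (count-cong λ e′ → trans (sym (cut-cong (count≤1⇒singleton X Xv X≤1) e′)) (cut-X e′))
        (count-singleton e))))))

    -- With two loops, `e` is the only edge leaving `v`, so `X` and the singleton of `v` have the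
    -- same cut. Their symmetric difference has an empty cut and misses `v`, so it is empty.
    two-loops⇒single : loopCount G v ≡ 2 → count X ≤ 1
    two-loops⇒single loops = ≤-reflexive (trans (count-cong λ w → xor≡false⇒≡ (X≗v w (bool-cases (X w xor (v == w))))) (count-singleton v))
      where
      one-cut : count (cut (v ==_)) ≡ 1
      one-cut = +-cancelʳ-≡ 4 _ _ (sym (trans (degree-loops v) (cong (λ x → count (cut (v ==_)) + 2 * x) loops)))
      cut-xor-v : ∀ e′ → cut (λ w → X w xor (v == w)) e′ ≡ false
      cut-xor-v e′ = trans (cut-xor X (v ==_) e′) (trans (cong₂ _xor_ (cut-X e′)
        (count≤1⇒singleton (cut (v ==_)) cut-v (≤-reflexive one-cut) e′)) (xor-same (e == e′)))
      X≗v : ∀ w → X w xor (v == w) ≡ true ⊎ X w xor (v == w) ≡ false → X w xor (v == w) ≡ false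
      X≗v w (inj₂ q) = q
      X≗v w (inj₁ q) = ⊥-elim (uncut (λ w → X w xor (v == w)) cut-xor-v {u = w} {v = v} q (cong₂ _xor_ Xv (==-refl v)))

  -- Otherwise the bridge alone would be a factor with all degrees 1.
  not-both-single : (X : VSet (n G)) {e : Edge G} → (∀ e′ → cut X e′ ≡ (e == e′)) →
                    count X ≤ 1 → count (not ∘ X) ≤ 1 → ⊥
  not-both-single X {e} cut-X X≤1 Y≤1 = no-factor ((e ==_) , λ v → inj₂ (trans (∑-point (λ e → incidence v (ends G e)) e)
      (covered v (bool-cases (X v)))))
    where
    one : ∀ Y → cut Y e ≡ true → count Y ≤ 1 → ∀ {v} → Y v ≡ true → incidence v (ends G e) ≡ 1
    one Y cut-e Y≤1 {v} Yv = trans (cut-incidence Y Yv cut-e)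
      (cong ⟦_⟧ (trans (sym (count≤1⇒singleton Y (inner∈ Y cut-e) Y≤1 v)) Yv))
    cut-e : cut X e ≡ true
    cut-e = trans (cut-X e) (==-refl e)
    covered : ∀ v → X v ≡ true ⊎ X v ≡ false → incidence v (ends G e) ≡ 1
    covered v (inj₁ Xv) = one X cut-e X≤1 Xv
    covered v (inj₂ ¬Xv) = one (not ∘ X) (trans (sym (cut-not X e)) cut-e) Y≤1 (cong not ¬Xv)

  bridge-loops : ∀ e → IsBridge G e →
    (loopCount G (proj₁ (ends G e)) ≡ 2 × ¬ loopCount G (proj₂ (ends G e)) ≡ 2) ⊎
    (¬ loopCount G (proj₁ (ends G e)) ≡ 2 × loopCount G (proj₂ (ends G e)) ≡ 2)
  bridge-loops e bridge with bridge-side e bridge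
  ... | X , cut-X = oriented (bool-cases (X a)) (bool-cases (X b))
    where
    a b : Vertex G
    a = proj₁ (ends G e)
    b = proj₂ (ends G e)
    Goal : Set
    Goal = (loopCount G a ≡ 2 × ¬ loopCount G b ≡ 2) ⊎ (¬ loopCount G a ≡ 2 × loopCount G b ≡ 2)
    with-side : ∀ Y → (∀ e′ → cut Y e′ ≡ (e == e′)) → Y a ≡ true → Y b ≡ false → Goal
    with-side Y cut-Y Ya ¬Yb = cases
        (small-side Y (no-cut₁ regular smaller no-factor Y (trans (count-cong cut-Y) (count-singleton e))))
      where
      a≢b : (a == b) ≡ false
      a≢b = ==-separates Y Ya ¬Yb
      module LeafA = Leaf Y cut-Y Ya (cong₂ _xor_ (==-refl a) a≢b)
      module LeafB = Leaf (not ∘ Y) (λ e′ → trans (sym (cut-not Y e′)) (cut-Y e′)) (cong not ¬Yb)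
                          (cong₂ _xor_ (trans (==-sym b a) a≢b) (==-refl b))
      cases : count Y ≤ 1 ⊎ count (not ∘ Y) ≤ 1 → Goal
      -- Two loops at the other end would make its side single too.
      cases (inj₁ Y≤1) = inj₁ (LeafA.single⇒two-loops Y≤1 ,
                               λ loops → not-both-single Y cut-Y Y≤1 (LeafB.two-loops⇒single loops))
      cases (inj₂ Z≤1) = inj₂ ((λ loops → not-both-single Y cut-Y (LeafA.two-loops⇒single loops) Z≤1) ,
                               LeafB.single⇒two-loops Z≤1)
    cut-e : X a xor X b ≡ true
    cut-e = trans (cut-X e) (==-refl e)
    oriented : X a ≡ true ⊎ X a ≡ false → X b ≡ true ⊎ X b ≡ false → Goal
    oriented (inj₁ p) (inj₂ q) = with-side X cut-X p q
    oriented (inj₂ p) (inj₁ q) = with-side (not ∘ X) (λ e′ → trans (sym (cut-not X e′)) (cut-X e′)) (cong not p) (cong not q)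
    oriented (inj₁ p) (inj₁ q) = ⊥-elim (true≢false cut-e (cong₂ _xor_ p q))
    oriented (inj₂ p) (inj₂ q) = ⊥-elim (true≢false cut-e (cong₂ _xor_ p q))

  -- Minimal cuts of three edges.

  inner-incident : (X : VSet (n G)) (e : Edge G) → IncidentTo G e (inner X e)
  inner-incident X e with X (proj₁ (ends G e))
  ... | true = inj₁ refl
  ... | false = inj₂ refl

  -- All three edges end in the only vertex of `X`, and 5 = 3 + 2 * 1 leaves room for exactly one
  -- loop.
  single-side-3-cut : (X : VSet (n G)) → count (cut X) ≡ 3 → count X ≤ 1 →
    ∃[ w ] ((∀ e → cut X e ≡ true → IncidentTo G e w) × IncidentToLoop G w)
  single-side-3-cut X cut≡3 X≤1 with count>0⇒member (cut X) (≤-trans (s≤s z≤n) (≤-reflexive (sym cut≡3)))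
  ... | e₀ , q₀ = w , incident , loop (count>0⇒member (ins (w ==_)) (≤-reflexive (sym one-loop)))
    where
    w : Vertex G
    w = inner X e₀
    X≗w : ∀ v → X v ≡ (w == v)
    X≗w = count≤1⇒singleton X (inner∈ X q₀) X≤1
    incident : ∀ e → cut X e ≡ true → IncidentTo G e w
    incident e q = subst (IncidentTo G e) (sym (==⇒≡ (trans (sym (X≗w (inner X e))) (inner∈ X q)))) (inner-incident X e)
    one-loop : count (ins (w ==_)) ≡ 1
    one-loop = *-cancelˡ-≡ _ _ 2 (+-cancelˡ-≡ 3 _ _ (begin
      3 + 2 * count (ins (w ==_)) ≡⟨ cong (_+ 2 * count (ins (w ==_))) (trans (count-cong (cut-cong (λ v → sym (X≗w v)))) cut≡3) ⟨
      count (cut (w ==_)) + 2 * count (ins (w ==_)) ≡⟨ cut-handshake regular (w ==_) ⟨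
      5 * count (w ==_) ≡⟨ cong (5 *_) (count-singleton w) ⟩
      5 ∎))
      where open ≡-Reasoning
    loop : (∃[ e ] ins (w ==_) e ≡ true) → IncidentToLoop G w
    loop (e , q) = e , cong₂ _,_ (sym (==⇒≡ (proj₁ (∧-true q)))) (sym (==⇒≡ (proj₂ (∧-true {w == proj₁ (ends G e)} q))))

  3-cut-star : ∀ S → ∣ S ∣ ≡ 3 → MinimalEdgeCut G S →
    ∃[ w ] ((∀ e → e ∈ S → IncidentTo G e w) × IncidentToLoop G w)
  3-cut-star S S≡3 minimal = star (minimal-cut-side S minimal)
    where
    Star-at-loop : VSet (m G) → Set
    Star-at-loop F = ∃[ w ] ((∀ e → F e ≡ true → IncidentTo G e w) × IncidentToLoop G w)
    restrict : ∀ {F} → (∀ e → lookup S e ≡ F e) → Star-at-loop F →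
               ∃[ w ] ((∀ e → e ∈ S → IncidentTo G e w) × IncidentToLoop G w)
    restrict S≗F (w , incident , loop) = w , (λ e e∈S → incident e (trans (sym (S≗F e)) ([]=⇒lookup e∈S))) , loop
    star : (∃[ X ] (∀ e → cut X e ≡ lookup S e)) → ∃[ w ] ((∀ e → e ∈ S → IncidentTo G e w) × IncidentToLoop G w)
    star (X , cut≗S) = side (small-side X (no-cut₃ regular smaller no-factor X cut≡3))
      where
      cut≡3 : count (cut X) ≡ 3
      cut≡3 = trans (count-cong cut≗S) (trans (sym (∣∣≡count S)) S≡3)
      side : count X ≤ 1 ⊎ count (not ∘ X) ≤ 1 → ∃[ w ] ((∀ e → e ∈ S → IncidentTo G e w) × IncidentToLoop G w)
      side (inj₁ X≤1) = restrict (λ e → sym (cut≗S e)) (single-side-3-cut X cut≡3 X≤1)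
      side (inj₂ Y≤1) = restrict (λ e → trans (sym (cut≗S e)) (cut-not X e))
        (single-side-3-cut (not ∘ X) (trans (sym (count-cong (cut-not X))) cut≡3) Y≤1)

theorem7 : (G : Graph) → Regular 5 G → ¬ Has41Factor G
    → (∀ (H : Graph) → n H < n G → Regular 5 H → Has41Factor H)
    → Connected G
    × (∃[ S ] (∣ S ∣ ≡ 3 × EdgeCut G S))
    × (∀ S → ∣ S ∣ ≡ 2 → ¬ MinimalEdgeCut G S)
    × (¬ (∃[ e₁ ] ∃[ e₂ ] (e₁ ≢ e₂ × IsBridge G e₁ × IsBridge G e₂)))
    × (∀ e → IsBridge G e →
    (loopCount G (proj₁ (ends G e)) ≡ 2 × ¬ loopCount G (proj₂ (ends G e)) ≡ 2)
    ⊎ (¬ loopCount G (proj₁ (ends G e)) ≡ 2 × loopCount G (proj₂ (ends G e)) ≡ 2))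
    × (∀ S → ∣ S ∣ ≡ 3 → MinimalEdgeCut G S →
    ∃[ w ] ((∀ e → e ∈ S → IncidentTo G e w) × IncidentToLoop G w))
theorem7 G regular no-factor smaller =
  connected , three-edge-cut , no-2-cut , no-two-bridges , bridge-loops , 3-cut-star
  where open MinimalCounterexample G regular no-factor smaller
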